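{- Let $M$ be a linear $\lambda$-term. If $\Gamma\vdash M:\sigma$ and $M\to_\beta^* N$, then $\Gamma\vdash N:\sigma$.
   Context: Types: $\sigma ::= \varphi \mid \sigma\to\sigma \mid \sigma\wedge\sigma \mid \sigma\vee\sigma$ ($\varphi$ atomic). A $\lambda$-term is linear if each free or bound variable occurs exactly once in it. Environments are finite sets of assumptions $x:\sigma$ with distinct variables; $\Gamma_1,\Gamma_2$ denotes union of environments with disjoint variables. Rules: (Ax) $x:\sigma\vdash x:\sigma$; ($\to$I) from $\Gamma,x:\sigma\vdash M:\tau$ infer $\Gamma\vdash\lambda x.M:\sigma\to\tau$; ($\to$E) from $\Gamma_1\vdash M:\sigma\to\tau$ and $\Gamma_2\vdash N:\sigma$ infer $\Gamma_1,\Gamma_2\vdash MN:\tau$; ($\wedge$I) from $\Gamma\vdash M:\sigma$ and $\Gamma\vdash M:\tau$ infer $\Gamma\vdash M:\sigma\wedge\tau$; ($\wedge$E) from $\Gamma\vdash M:\sigma\wedge\tau$ infer $\Gamma\vdash M:\sigma$ and $\Gamma\vdash M:\tau$; ($\vee$I) from $\Gamma\vdash M:\sigma$ infer $\Gamma\vdash M:\sigma\vee\tau$ and $\Gamma\vdash M:\tau\vee\sigma$; ($\vee$E) from $\Gamma_1,x:\sigma\wedge\theta\vdash M:\rho$, $\Gamma_1,x:\tau\wedge\theta\vdash M:\rho$ and $\Gamma_2\vdash N:(\sigma\vee\tau)\wedge\theta$ infer $\Gamma_1,\Gamma_2\vdash M[N/x]:\rho$. -}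

module Defs where

-- Locally nameless presentation of the untyped λ-calculus:
-- free variables are names (ℕ), bound variables are de Bruijn indices.
-- This makes terms identical up to α-conversion and makes substitution
-- automatically capture-avoiding, as in the paper (terms modulo α).

open import Data.Nat using (ℕ; zero; suc; _+_; _≤_; _≟_)
open import Data.List using (List; []; _∷_; [_]; _++_; map)
open import Data.Product using (_×_; _,_; proj₁)
open import Data.Unit using (⊤)
open import Relation.Nullary using (yes; no)
open import Relation.Binary.PropositionalEquality using (_≡_)
open import Data.List.Membership.Propositional using (_∉_)
open import Data.List.Relation.Unary.Unique.Propositional using (Unique)
open import Data.List.Relation.Binary.Permutation.Propositional using (_↭_)
open import Relation.Binary.Construct.Closure.ReflexiveTransitive using (Star)

infixr 7 _⇒_
infixr 8 _∨_
infixr 9 _∧_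

data Ty : Set where
  atom : ℕ → Ty
  _⇒_  : Ty → Ty → Ty
  _∧_  : Ty → Ty → Ty
  _∨_  : Ty → Ty → Ty

data Term : Set where
  bvar : ℕ → Term
  fvar : ℕ → Term
  lam  : Term → Term
  app  : Term → Term → Term

fv : Term → List ℕ
fv (bvar _)  = []
fv (fvar x)  = [ x ]
fv (lam t)   = fv t
fv (app t u) = fv t ++ fv u

openAt : ℕ → Term → Term → Term
openAt k u (bvar j) with j ≟ k
... | yes _ = u
... | no  _ = bvar j
openAt k u (fvar x)  = fvar x
openAt k u (lam t)   = lam (openAt (suc k) u t)
openAt k u (app t s) = app (openAt k u t) (openAt k u s)

_^_ : Term → Term → Term
t ^ u = openAt 0 u t

_[_/_] : Term → Term → ℕ → Term
bvar j    [ N / x ] = bvar j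
fvar y    [ N / x ] with y ≟ x
... | yes _ = N
... | no  _ = fvar y
lam t     [ N / x ] = lam (t [ N / x ])
app t s   [ N / x ] = app (t [ N / x ]) (s [ N / x ])

countF : ℕ → Term → ℕ
countF x (bvar _) = 0
countF x (fvar y) with y ≟ x
... | yes _ = 1
... | no  _ = 0
countF x (lam t)   = countF x t
countF x (app t u) = countF x t + countF x u

countB : ℕ → Term → ℕ
countB k (bvar j) with j ≟ k
... | yes _ = 1
... | no  _ = 0
countB k (fvar _)  = 0
countB k (lam t)   = countB (suc k) t
countB k (app t u) = countB k t + countB k u

BindersLinear : Term → Set
BindersLinear (bvar _)  = ⊤
BindersLinear (fvar _)  = ⊤
BindersLinear (lam t)   = countB 0 t ≡ 1 × BindersLinear t
BindersLinear (app t u) = BindersLinear t × BindersLinear u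

Linear : Term → Set
Linear t = BindersLinear t × (∀ x → countF x t ≤ 1)

infix 4 _⟶β_ _⟶β*_

data _⟶β_ : Term → Term → Set where
  β    : ∀ {t u} → app (lam t) u ⟶β (t ^ u)
  appL : ∀ {t t' u} → t ⟶β t' → app t u ⟶β app t' u
  appR : ∀ {t u u'} → u ⟶β u' → app t u ⟶β app t u'
  ξ    : ∀ {t t'} (x : ℕ) → x ∉ fv t → x ∉ fv t' →
         (t ^ fvar x) ⟶β (t' ^ fvar x) → lam t ⟶β lam t'

_⟶β*_ : Term → Term → Set
_⟶β*_ = Star _⟶β_

-- Environments: lists of assumptions x : σ, considered up to permutation
-- (i.e. as finite sets); Γ₁,Γ₂ is the union of environments with
-- disjoint variables.

Env : Set
Env = List (ℕ × Ty)

dom : Env → List ℕ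
dom = map proj₁

Split : Env → Env → Env → Set
Split Γ Γ₁ Γ₂ = (Γ ↭ Γ₁ ++ Γ₂) × Unique (dom (Γ₁ ++ Γ₂))

infix 3 _⊢_∶_

data _⊢_∶_ : Env → Term → Ty → Set where
  Ax  : ∀ {x σ} → [ (x , σ) ] ⊢ fvar x ∶ σ
  ⇒I  : ∀ {Γ M σ τ} (x : ℕ) → x ∉ dom Γ → x ∉ fv M →
        ((x , σ) ∷ Γ) ⊢ M ^ fvar x ∶ τ → Γ ⊢ lam M ∶ σ ⇒ τ
  ⇒E  : ∀ {Γ Γ₁ Γ₂ M N σ τ} → Split Γ Γ₁ Γ₂ →
        Γ₁ ⊢ M ∶ σ ⇒ τ → Γ₂ ⊢ N ∶ σ → Γ ⊢ app M N ∶ τ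
  ∧I  : ∀ {Γ M σ τ} → Γ ⊢ M ∶ σ → Γ ⊢ M ∶ τ → Γ ⊢ M ∶ σ ∧ τ
  ∧E₁ : ∀ {Γ M σ τ} → Γ ⊢ M ∶ σ ∧ τ → Γ ⊢ M ∶ σ
  ∧E₂ : ∀ {Γ M σ τ} → Γ ⊢ M ∶ σ ∧ τ → Γ ⊢ M ∶ τ
  ∨I₁ : ∀ {Γ M σ τ} → Γ ⊢ M ∶ σ → Γ ⊢ M ∶ σ ∨ τ
  ∨I₂ : ∀ {Γ M σ τ} → Γ ⊢ M ∶ σ → Γ ⊢ M ∶ τ ∨ σ
  ∨E  : ∀ {Γ Γ₁ Γ₂ M N σ τ θ ρ} (x : ℕ) → Split Γ Γ₁ Γ₂ → x ∉ dom Γ₁ →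
        ((x , σ ∧ θ) ∷ Γ₁) ⊢ M ∶ ρ →
        ((x , τ ∧ θ) ∷ Γ₁) ⊢ M ∶ ρ →
        Γ₂ ⊢ N ∶ (σ ∨ τ) ∧ θ →
        Γ ⊢ M [ N / x ] ∶ ρ

-- The difficulty is (∨E): its last step may substitute the operator λx.P of a redex, so the type
-- of λx.P need not be an arrow.  Typability of M[N/z], z occurring once, factors through a single
-- type of N (by intersections when N is typed several times, unions when a case distinction inside
-- N changes its type).  So every neutral subterm of P that avoids x can be replaced by an
-- assumption, and, after case distinction, by an assumption of a prime type (a union only below an
-- arrow).  Once all of them are prime, λx.P : ψ holds only for the obvious reason: choosing
-- sides in ψ leaves arrows σ ⇒ τ for which P has type τ under x : σ.  Then the redex can be
-- contracted, and the case distinctions are redone on the reduct; for those on subterms of the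
-- argument this needs linearity, since such a subterm must still occur exactly once.
--
-- For a reduction below a binder λ, the same replacement is made in the body of λ, sparing
-- abstractions so that the redex survives.
module Submission where

open import Defs
open import Data.Nat using (ℕ; zero; suc; _+_; _*_; _≟_; _≤_; _<_; z≤n; s≤s)
open import Data.Nat.Properties
  using (*-zeroʳ; *-identityˡ; +-identityʳ; +-assoc; ≤-trans; ≤-refl;
         ≤-pred; m≤n⇒m≤1+n; ≤∧≢⇒<; m≤m+n; m≤n+m; 1+n≰n)
  renaming (suc-injective to ℕ-suc-injective)
open import Data.Nat.Solver using (module +-*-Solver)
open import Data.Fin using (Fin; zero; suc; toℕ)
open import Data.Fin.Properties using (suc-injective)
open import Data.List using (List; []; _∷_; [_]; _++_; map)
open import Data.List.Relation.Unary.Any using (here; there)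
open import Data.List.Membership.Propositional using (_∈_; _∉_)
open import Data.List.Membership.Propositional.Properties using (∈-++⁺ˡ; ∈-++⁺ʳ)
open import Data.List.Properties using (map-++; map-∘; map-id)
open import Data.List.Relation.Unary.All using (All; []; _∷_)
open import Data.List.Relation.Unary.All.Properties
  using (¬Any⇒All¬; All¬⇒¬Any) renaming (++⁻ to All-++⁻; ++⁻ˡ to All-++⁻ˡ)
open import Data.List.Relation.Unary.AllPairs using ([]; _∷_)
open import Data.List.Relation.Unary.Unique.Propositional using (Unique)
open import Data.List.Relation.Binary.Permutation.Propositional
  using (_↭_; refl; prep; swap; ↭-refl; ↭-sym; ↭-trans; ↭⇒↭ₛ)
open import Data.List.Relation.Binary.Permutation.Propositional.Properties
  using (++⁺; ++⁺ˡ; ++⁺ʳ; ++-comm; ++-assoc; shift; drop-∷; map⁺; All-resp-↭; ∈-resp-↭;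
         ↭-singleton-inv)
open import Data.List.Relation.Binary.Permutation.Setoid.Properties using (Unique-resp-↭)
open import Data.Product using (∃-syntax; _×_; _,_; proj₁; proj₂)
open import Data.Sum using (_⊎_; inj₁; inj₂)
open import Data.Empty using (⊥; ⊥-elim)
open import Data.Unit using (⊤; tt)
open import Function using (_∘_; id)
open import Relation.Nullary using (¬_; Dec; yes; no)
open import Relation.Binary.PropositionalEquality
  using (_≡_; _≢_; refl; sym; trans; cong; cong₂; subst; subst₂; setoid)
open import Relation.Binary.Construct.Closure.ReflexiveTransitive using (Star; ε; _◅_; _◅◅_; gmap)

open +-*-Solver using (solve; _:+_; _:*_; _:=_)

-- Scoped terms: renaming and substitution.

infixl 7 _·_
infix 7 _◃_ _▹_

-- Scoped terms without free names: a leaf hyp α is a free variable together with the type assumed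
-- for it.  By linearity it stands for a single occurrence, so no environment is needed.
data Tm (n : ℕ) : Set where
  var : Fin n → Tm n
  hyp : Ty → Tm n
  ƛ   : Tm (suc n) → Tm n
  _·_ : Tm n → Tm n → Tm n

extᵣ : ∀ {m n} → (Fin m → Fin n) → Fin (suc m) → Fin (suc n)
extᵣ ρ zero    = zero
extᵣ ρ (suc i) = suc (ρ i)

ren : ∀ {m n} → (Fin m → Fin n) → Tm m → Tm n
ren ρ (var i) = var (ρ i)
ren ρ (hyp α) = hyp α
ren ρ (ƛ t)   = ƛ (ren (extᵣ ρ) t)
ren ρ (t · u) = ren ρ t · ren ρ u

extₛ : ∀ {m n} → (Fin m → Tm n) → Fin (suc m) → Tm (suc n)
extₛ σ zero    = var zero
extₛ σ (suc i) = ren suc (σ i)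

sub : ∀ {m n} → (Fin m → Tm n) → Tm m → Tm n
sub σ (var i) = σ i
sub σ (hyp α) = hyp α
sub σ (ƛ t)   = ƛ (sub (extₛ σ) t)
sub σ (t · u) = sub σ t · sub σ u

inst : ∀ {n} → Tm n → Fin (suc n) → Tm n
inst u zero    = u
inst u (suc i) = var i

infix 8 _⟨_⟩

_⟨_⟩ : ∀ {n} → Tm (suc n) → Tm n → Tm n
t ⟨ u ⟩ = sub (inst u) t

ren-ren : ∀ {l m n} {ρ : Fin m → Fin n} {ρ′ : Fin l → Fin m} {ρ″ : Fin l → Fin n} →
          (∀ i → ρ (ρ′ i) ≡ ρ″ i) → ∀ t → ren ρ (ren ρ′ t) ≡ ren ρ″ t
ren-ren e (var i) = cong var (e i)
ren-ren e (hyp α) = refl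
ren-ren e (ƛ t)   = cong ƛ (ren-ren (λ { zero → refl ; (suc i) → cong suc (e i) }) t)
ren-ren e (t · u) = cong₂ _·_ (ren-ren e t) (ren-ren e u)

sub-ren : ∀ {l m n} {σ : Fin m → Tm n} {ρ : Fin l → Fin m} {σ′ : Fin l → Tm n} →
          (∀ i → σ (ρ i) ≡ σ′ i) → ∀ t → sub σ (ren ρ t) ≡ sub σ′ t
sub-ren e (var i) = e i
sub-ren e (hyp α) = refl
sub-ren e (ƛ t)   = cong ƛ (sub-ren (λ { zero → refl ; (suc i) → cong (ren suc) (e i) }) t)
sub-ren e (t · u) = cong₂ _·_ (sub-ren e t) (sub-ren e u)

ren-ext-suc : ∀ {m n} {ρ : Fin m → Fin n} t → ren (extᵣ ρ) (ren suc t) ≡ ren suc (ren ρ t)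
ren-ext-suc t = trans (ren-ren (λ _ → refl) t) (sym (ren-ren (λ _ → refl) t))

ren-sub : ∀ {l m n} {ρ : Fin m → Fin n} {σ : Fin l → Tm m} {σ′ : Fin l → Tm n} →
          (∀ i → ren ρ (σ i) ≡ σ′ i) → ∀ t → ren ρ (sub σ t) ≡ sub σ′ t
ren-sub e (var i) = e i
ren-sub e (hyp α) = refl
ren-sub {σ = σ} e (ƛ t) = cong ƛ (ren-sub
  (λ { zero → refl ; (suc i) → trans (ren-ext-suc (σ i)) (cong (ren suc) (e i)) }) t)
ren-sub e (t · u) = cong₂ _·_ (ren-sub e t) (ren-sub e u)

sub-ext-suc : ∀ {m n} {σ : Fin m → Tm n} t → sub (extₛ σ) (ren suc t) ≡ ren suc (sub σ t)
sub-ext-suc t = trans (sub-ren (λ _ → refl) t) (sym (ren-sub (λ _ → refl) t))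

sub-sub : ∀ {l m n} {σ : Fin m → Tm n} {σ′ : Fin l → Tm m} {σ″ : Fin l → Tm n} →
          (∀ i → sub σ (σ′ i) ≡ σ″ i) → ∀ t → sub σ (sub σ′ t) ≡ sub σ″ t
sub-sub e (var i) = e i
sub-sub e (hyp α) = refl
sub-sub {σ′ = σ′} e (ƛ t) = cong ƛ (sub-sub
  (λ { zero → refl ; (suc i) → trans (sub-ext-suc (σ′ i)) (cong (ren suc) (e i)) }) t)
sub-sub e (t · u) = cong₂ _·_ (sub-sub e t) (sub-sub e u)

sub-id : ∀ {n} {σ : Fin n → Tm n} → (∀ i → σ i ≡ var i) → ∀ t → sub σ t ≡ t
sub-id e (var i) = e i
sub-id e (hyp α) = refl
sub-id e (ƛ t)   = cong ƛ (sub-id (λ { zero → refl ; (suc i) → cong (ren suc) (e i) }) t)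
sub-id e (t · u) = cong₂ _·_ (sub-id e t) (sub-id e u)

ren-id : ∀ {n} {ρ : Fin n → Fin n} → (∀ i → ρ i ≡ i) → ∀ t → ren ρ t ≡ t
ren-id e (var i) = cong var (e i)
ren-id e (hyp α) = refl
ren-id e (ƛ t)   = cong ƛ (ren-id (λ { zero → refl ; (suc i) → cong suc (e i) }) t)
ren-id e (t · u) = cong₂ _·_ (ren-id e t) (ren-id e u)

inst-suc : ∀ {n} (u : Tm n) t → sub (inst u) (ren suc t) ≡ t
inst-suc u t = trans (sub-ren (λ _ → refl) t) (sub-id (λ _ → refl) t)

sub-inst : ∀ {m n} (σ : Fin m → Tm n) P Q → sub σ (P ⟨ Q ⟩) ≡ sub (extₛ σ) P ⟨ sub σ Q ⟩
sub-inst σ P Q = trans (sub-sub (λ _ → refl) P) (sym (sub-sub pointwise P))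
  where
  pointwise : ∀ i → sub (inst (sub σ Q)) (extₛ σ i) ≡ sub σ (inst Q i)
  pointwise zero    = refl
  pointwise (suc i) = inst-suc _ (σ i)

ren-inst : ∀ {m n} (ρ : Fin m → Fin n) P Q → ren ρ (P ⟨ Q ⟩) ≡ ren (extᵣ ρ) P ⟨ ren ρ Q ⟩
ren-inst ρ P Q =
  trans (ren-sub (λ _ → refl) P) (sym (sub-ren (λ { zero → refl ; (suc i) → refl }) P))

-- Closed terms and contexts with one hole.

wk : ∀ {n} → Tm 0 → Tm n
wk = ren (λ ())

wk-id : ∀ t → wk t ≡ t
wk-id = ren-id (λ ())

ren-wk : ∀ {m n} (ρ : Fin m → Fin n) t → ren ρ (wk t) ≡ wk t
ren-wk ρ = ren-ren (λ ())

sub-wk : ∀ {m n} (σ : Fin m → Tm n) t → sub σ (wk t) ≡ wk t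
sub-wk σ t = trans (sub-ren (λ ()) t) (sub-empty t)
  where
  sub-empty : ∀ t → sub (λ ()) t ≡ wk t
  sub-empty t = trans (sym (ren-sub {σ = λ ()} (λ ()) t)) (cong wk (sub-id (λ ()) t))

-- The hole is always filled with a closed term, so filling it captures nothing.
data Ctx (n : ℕ) : Set where
  hole : Ctx n
  _◃_  : Ctx n → Tm n → Ctx n
  _▹_  : Tm n → Ctx n → Ctx n
  ƛ    : Ctx (suc n) → Ctx n

infix 8 _⟦_⟧

_⟦_⟧ : ∀ {n} → Ctx n → Tm 0 → Tm n
hole    ⟦ N ⟧ = wk N
(C ◃ u) ⟦ N ⟧ = C ⟦ N ⟧ · u
(t ▹ C) ⟦ N ⟧ = t · C ⟦ N ⟧
ƛ C     ⟦ N ⟧ = ƛ (C ⟦ N ⟧)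

renC : ∀ {m n} → (Fin m → Fin n) → Ctx m → Ctx n
renC ρ hole    = hole
renC ρ (C ◃ u) = renC ρ C ◃ ren ρ u
renC ρ (t ▹ C) = ren ρ t ▹ renC ρ C
renC ρ (ƛ C)   = ƛ (renC (extᵣ ρ) C)

subC : ∀ {m n} → (Fin m → Tm n) → Ctx m → Ctx n
subC σ hole    = hole
subC σ (C ◃ u) = subC σ C ◃ sub σ u
subC σ (t ▹ C) = sub σ t ▹ subC σ C
subC σ (ƛ C)   = ƛ (subC (extₛ σ) C)

ren-plug : ∀ {m n} (ρ : Fin m → Fin n) C N → ren ρ (C ⟦ N ⟧) ≡ renC ρ C ⟦ N ⟧
ren-plug ρ hole    N = ren-wk ρ N
ren-plug ρ (C ◃ u) N = cong (_· _) (ren-plug ρ C N)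
ren-plug ρ (t ▹ C) N = cong (_ ·_) (ren-plug ρ C N)
ren-plug ρ (ƛ C)   N = cong ƛ (ren-plug (extᵣ ρ) C N)

sub-plug : ∀ {m n} (σ : Fin m → Tm n) C N → sub σ (C ⟦ N ⟧) ≡ subC σ C ⟦ N ⟧
sub-plug σ hole    N = sub-wk σ N
sub-plug σ (C ◃ u) N = cong (_· _) (sub-plug σ C N)
sub-plug σ (t ▹ C) N = cong (_ ·_) (sub-plug σ C N)
sub-plug σ (ƛ C)   N = cong ƛ (sub-plug (extₛ σ) C N)

-- Comparing two positions in a term.

Injective : ∀ {m n} → (Fin m → Fin n) → Set
Injective ρ = ∀ i j → ρ i ≡ ρ j → i ≡ j

extᵣ-injective : ∀ {m n} {ρ : Fin m → Fin n} → Injective ρ → Injective (extᵣ ρ)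
extᵣ-injective inj zero    zero    e = refl
extᵣ-injective inj (suc i) (suc j) e = cong suc (inj i j (suc-injective e))

var-injective : ∀ {n} {i j : Fin n} → var i ≡ var j → i ≡ j
var-injective refl = refl

ƛ-injective : ∀ {n} {t u : Tm (suc n)} → Tm.ƛ t ≡ ƛ u → t ≡ u
ƛ-injective refl = refl

·-injective : ∀ {n} {t t′ u u′ : Tm n} → t · u ≡ t′ · u′ → t ≡ t′ × u ≡ u′
·-injective refl = refl , refl

ren-injective : ∀ {m n} {ρ : Fin m → Fin n} → Injective ρ → ∀ t u → ren ρ t ≡ ren ρ u → t ≡ u
ren-injective inj (var i)  (var j)   e    = cong var (inj i j (var-injective e))
ren-injective inj (hyp α)  (hyp .α)  refl = refl
ren-injective inj (ƛ t)    (ƛ u)     e    =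
  cong ƛ (ren-injective (extᵣ-injective inj) t u (ƛ-injective e))
ren-injective inj (t · t′) (u · u′)  e    with e₁ , e₂ ← ·-injective e =
  cong₂ _·_ (ren-injective inj t u e₁) (ren-injective inj t′ u′ e₂)

-- Closed fillings are fixed by renaming, so an occurrence of `B` in a renamed term comes from one
-- in the original; at the hole, injectivity cancels `ρ`.
unplug-ren : ∀ {m n} {ρ : Fin m → Fin n} → Injective ρ → ∀ D {B} t → D ⟦ B ⟧ ≡ ren ρ t →
             ∃[ E ] t ≡ E ⟦ B ⟧ × D ≡ renC ρ E
unplug-ren {ρ = ρ} inj hole {B} t e =
  hole , ren-injective inj t (wk B) (trans (sym e) (sym (ren-wk ρ B))) , refl
unplug-ren inj (D ◃ _) (t · u) e with e₁ , refl ← ·-injective e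
  with E , p , q ← unplug-ren inj D t e₁ = E ◃ u , cong (_· u) p , cong (_◃ _) q
unplug-ren inj (_ ▹ D) (t · u) e with refl , e₂ ← ·-injective e
  with E , p , q ← unplug-ren inj D u e₂ = t ▹ E , cong (t ·_) p , cong (_ ▹_) q
unplug-ren inj (ƛ D) (ƛ t) e
  with E , p , q ← unplug-ren (extᵣ-injective inj) D t (ƛ-injective e) = ƛ E , cong ƛ p , cong ƛ q

unplug-wk : ∀ {n} (D : Ctx n) {B} N → D ⟦ B ⟧ ≡ wk N →
            ∃[ E ] N ≡ E ⟦ B ⟧ × (∀ u → D ⟦ u ⟧ ≡ wk (E ⟦ u ⟧))
unplug-wk D N e with E , p , refl ← unplug-ren (λ ()) D N e = E , p , λ u → sym (ren-plug _ E u)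

-- Two occurrences of closed subterms are nested or disjoint. In `apart`, `C′ v` is `C` with `v` at
-- the position of the hole of `D`, and `D′ u` is `D` with `u` at that of `C`.
data Overlap {n} (C D : Ctx n) (N B : Tm 0) : Set where
  inner : ∀ E → B ≡ E ⟦ N ⟧ → (∀ u → C ⟦ u ⟧ ≡ D ⟦ E ⟦ u ⟧ ⟧) → Overlap C D N B
  outer : ∀ E → N ≡ E ⟦ B ⟧ → (∀ u → D ⟦ u ⟧ ≡ C ⟦ E ⟦ u ⟧ ⟧) → Overlap C D N B
  apart : (C′ D′ : Tm 0 → Ctx n) → (∀ u v → C′ v ⟦ u ⟧ ≡ D′ u ⟦ v ⟧) →
          (∀ u → C ⟦ u ⟧ ≡ C′ B ⟦ u ⟧) → (∀ v → D ⟦ v ⟧ ≡ D′ N ⟦ v ⟧) → Overlap C D N B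

overlap-cong : ∀ {m n} (K : Ctx m → Ctx n) (k : Tm m → Tm n) →
               (∀ X u → K X ⟦ u ⟧ ≡ k (X ⟦ u ⟧)) →
               ∀ {C D N B} → Overlap C D N B → Overlap (K C) (K D) N B
overlap-cong K k h {C} {D} (inner E p q) =
  inner E p (λ u → trans (h C u) (trans (cong k (q u)) (sym (h D _))))
overlap-cong K k h {C} {D} (outer E p q) =
  outer E p (λ u → trans (h D u) (trans (cong k (q u)) (sym (h C _))))
overlap-cong K k h {C} {D} (apart C′ D′ p q r) =
  apart (K ∘ C′) (K ∘ D′)
    (λ u v → trans (h _ u) (trans (cong k (p u v)) (sym (h _ v))))
    (λ u → trans (h C u) (trans (cong k (q u)) (sym (h _ u))))
    (λ v → trans (h D v) (trans (cong k (r v)) (sym (h _ v))))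

overlap-view : ∀ {n} (C D : Ctx n) {N B} → C ⟦ N ⟧ ≡ D ⟦ B ⟧ → Overlap C D N B
overlap-view hole D {N} e with E , p , q ← unplug-wk D N (sym e) = outer E p q
overlap-view C hole {N} {B} e with E , p , q ← unplug-wk C B e = inner E p q
overlap-view (C ◃ u) (D ◃ _) e with e₁ , refl ← ·-injective e =
  overlap-cong (_◃ u) (_· u) (λ _ _ → refl) (overlap-view C D e₁)
overlap-view (t ▹ C) (_ ▹ D) e with refl , e₂ ← ·-injective e =
  overlap-cong (t ▹_) (t ·_) (λ _ _ → refl) (overlap-view C D e₂)
overlap-view (ƛ C) (ƛ D) e = overlap-cong ƛ ƛ (λ _ _ → refl) (overlap-view C D (ƛ-injective e))
overlap-view (C ◃ u) (t ▹ D) e with refl , refl ← ·-injective e =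
  apart (λ v → C ◃ D ⟦ v ⟧) (λ v → C ⟦ v ⟧ ▹ D) (λ _ _ → refl) (λ _ → refl) (λ _ → refl)
overlap-view (t ▹ C) (D ◃ u) e with refl , refl ← ·-injective e =
  apart (λ v → D ⟦ v ⟧ ▹ C) (λ v → D ◃ C ⟦ v ⟧) (λ _ _ → refl) (λ _ → refl) (λ _ → refl)

-- Occurrence counts, and substitution for a variable that occurs once.

δ : ∀ {n} → Fin n → Fin n → ℕ
δ zero    zero    = 1
δ zero    (suc j) = 0
δ (suc i) zero    = 0
δ (suc i) (suc j) = δ i j

cnt : ∀ {n} → Fin n → Tm n → ℕ
cnt i (var j) = δ i j
cnt i (hyp α) = 0
cnt i (ƛ t)   = cnt (suc i) t
cnt i (t · u) = cnt i t + cnt i u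

cnt-ren-∉ : ∀ {m n} {ρ : Fin m → Fin n} i → (∀ j → δ i (ρ j) ≡ 0) → ∀ t → cnt i (ren ρ t) ≡ 0
cnt-ren-∉ i h (var j) = h j
cnt-ren-∉ i h (hyp α) = refl
cnt-ren-∉ i h (ƛ t)   = cnt-ren-∉ (suc i) (λ { zero → refl ; (suc j) → h j }) t
cnt-ren-∉ i h (t · u) = cong₂ _+_ (cnt-ren-∉ i h t) (cnt-ren-∉ i h u)

cnt-plug : ∀ {n} (i : Fin n) C N M → cnt i (C ⟦ N ⟧) ≡ cnt i (C ⟦ M ⟧)
cnt-plug i hole    N M = trans (cnt-ren-∉ i (λ ()) N) (sym (cnt-ren-∉ i (λ ()) M))
cnt-plug i (C ◃ u) N M = cong (_+ _) (cnt-plug i C N M)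
cnt-plug i (t ▹ C) N M = cong (cnt i t +_) (cnt-plug i C N M)
cnt-plug i (ƛ C)   N M = cnt-plug (suc i) C N M

δ≡1⇒≡ : ∀ {n} (i j : Fin n) → δ i j ≡ 1 → i ≡ j
δ≡1⇒≡ zero    zero    e = refl
δ≡1⇒≡ (suc i) (suc j) e = cong suc (δ≡1⇒≡ i j e)

+≡0 : ∀ m {n} → m + n ≡ 0 → m ≡ 0 × n ≡ 0
+≡0 zero e = refl , e

+≡1 : ∀ m {n} → m + n ≡ 1 → (m ≡ 1 × n ≡ 0) ⊎ (m ≡ 0 × n ≡ 1)
+≡1 zero          e = inj₂ (refl , e)
+≡1 (suc zero)    e = inj₁ (refl , ℕ-suc-injective e)

extₛ-const : ∀ {m n} (i : Fin m) (σ : Tm 0 → Fin m → Tm n) →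
             (∀ j → δ i j ≡ 0 → ∀ u v → σ u j ≡ σ v j) →
             ∀ j → δ (suc i) j ≡ 0 → ∀ u v → extₛ (σ u) j ≡ extₛ (σ v) j
extₛ-const i σ h zero    e u v = refl
extₛ-const i σ h (suc j) e u v = cong (ren suc) (h j e u v)

sub-const : ∀ {m n} (i : Fin m) (σ : Tm 0 → Fin m → Tm n) →
            (∀ j → δ i j ≡ 0 → ∀ u v → σ u j ≡ σ v j) →
            ∀ t → cnt i t ≡ 0 → ∀ u v → sub (σ u) t ≡ sub (σ v) t
sub-const i σ h (var j) e u v = h j e u v
sub-const i σ h (hyp α) e u v = refl
sub-const i σ h (ƛ t)   e u v =
  cong ƛ (sub-const (suc i) (extₛ ∘ σ) (extₛ-const i σ h) t e u v)
sub-const i σ h (t · s) e u v with e₁ , e₂ ← +≡0 (cnt i t) e =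
  cong₂ _·_ (sub-const i σ h t e₁ u v) (sub-const i σ h s e₂ u v)

-- Only the value at `i` depends on `u`, and `i` occurs once, so `u` stays at a single position of
-- the result.
sub-linear : ∀ {m n} (i : Fin m) (σ : Tm 0 → Fin m → Tm n) →
             (∀ j → δ i j ≡ 0 → ∀ u v → σ u j ≡ σ v j) →
             (C : Ctx n) → (∀ u → σ u i ≡ C ⟦ u ⟧) →
             ∀ t → cnt i t ≡ 1 → ∃[ D ] ∀ u → sub (σ u) t ≡ D ⟦ u ⟧
sub-linear i σ h C p (var j) e with refl ← δ≡1⇒≡ i j e = C , p
sub-linear i σ h C p (ƛ t) e
  with D , q ← sub-linear (suc i) (extₛ ∘ σ) (extₛ-const i σ h) (renC suc C)
                 (λ u → trans (cong (ren suc) (p u)) (ren-plug suc C u)) t e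
  = ƛ D , λ u → cong ƛ (q u)
sub-linear i σ h C p (t · s) e with +≡1 (cnt i t) e
... | inj₁ (e₁ , e₂) with D , q ← sub-linear i σ h C p t e₁ =
  -- `hyp (atom 0)` is an arbitrary argument: `i` does not occur in `s`, so every choice gives the
  -- same term.
  D ◃ sub (σ (hyp (atom 0))) s , λ u → cong₂ _·_ (q u) (sub-const i σ h s e₂ u _)
... | inj₂ (e₁ , e₂) with D , q ← sub-linear i σ h C p s e₂ =
  sub (σ (hyp (atom 0))) t ▹ D , λ u → cong₂ _·_ (sub-const i σ h t e₁ u _) (q u)

-- Used to carry a position in the argument of a redex over to a position in the reduct.
linear-plug : ∀ {n} (P : Tm (suc n)) → cnt zero P ≡ 1 → (C : Ctx n) →
              ∃[ D ] ∀ u → P ⟨ C ⟦ u ⟧ ⟩ ≡ D ⟦ u ⟧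
linear-plug P e C = sub-linear zero (λ u → inst (C ⟦ u ⟧)) (λ { (suc j) _ _ _ → refl }) C
                      (λ _ → refl) P e

-- Typing of scoped terms

infix 3 _⊩_

-- split is (∨E) without the side type θ; dist recovers what θ is needed for.
data _⊩_ : Tm 0 → Ty → Set where
  ax    : ∀ {α} → hyp α ⊩ α
  ƛI    : ∀ {P σ τ} → cnt zero P ≡ 1 → P ⟨ hyp σ ⟩ ⊩ τ → ƛ P ⊩ σ ⇒ τ
  ·E    : ∀ {t u σ τ} → t ⊩ σ ⇒ τ → u ⊩ σ → t · u ⊩ τ
  ∧I    : ∀ {t σ τ} → t ⊩ σ → t ⊩ τ → t ⊩ σ ∧ τ
  ∧E₁   : ∀ {t σ τ} → t ⊩ σ ∧ τ → t ⊩ σ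
  ∧E₂   : ∀ {t σ τ} → t ⊩ σ ∧ τ → t ⊩ τ
  ∨I₁   : ∀ {t σ τ} → t ⊩ σ → t ⊩ σ ∨ τ
  ∨I₂   : ∀ {t σ τ} → t ⊩ τ → t ⊩ σ ∨ τ
  dist  : ∀ {t σ τ θ} → t ⊩ (σ ∨ τ) ∧ θ → t ⊩ (σ ∧ θ) ∨ (τ ∧ θ)
  split : ∀ {σ τ ρ} C N → C ⟦ hyp σ ⟧ ⊩ ρ → C ⟦ hyp τ ⟧ ⊩ ρ → N ⊩ σ ∨ τ → C ⟦ N ⟧ ⊩ ρ

⊩-≡ : ∀ {t u ρ} → t ≡ u → t ⊩ ρ → u ⊩ ρ
⊩-≡ refl d = d

-- Substitution is a case distinction whose two branches coincide.
cut : ∀ {α ρ} C {N} → C ⟦ hyp α ⟧ ⊩ ρ → N ⊩ α → C ⟦ N ⟧ ⊩ ρ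
cut C d e = split C _ d d (∨I₁ e)

-- Factoring a typing through one type of a subterm.

Factor : Ctx 0 → Tm 0 → Ty → Set
Factor C N ρ = ∃[ α ] N ⊩ α × C ⟦ hyp α ⟧ ⊩ ρ

factor-map : ∀ C {N ρ ρ′} → (∀ {t} → t ⊩ ρ → t ⊩ ρ′) →
             Factor C N ρ → Factor C N ρ′
factor-map C f (α , n , c) = α , n , f c

factor-hole : ∀ {t N ρ} → t ⊩ ρ → t ≡ wk N → Factor hole N ρ
factor-hole {N = N} d e = _ , ⊩-≡ (trans e (wk-id N)) d , ax

-- Induction on the derivation. Several typings of `N` are merged by an intersection, or by a union
-- when `N` contains the subject of the case distinction.
factor-≡ : ∀ {t ρ} → t ⊩ ρ → ∀ C N → t ≡ C ⟦ N ⟧ → Factor C N ρ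
factor-≡ d hole N e = factor-hole d e
factor-≡ (∧I d d′) C N e
  with α , n , c ← factor-≡ d C N e | α′ , n′ , c′ ← factor-≡ d′ C N e =
  α ∧ α′ , ∧I n n′ , ∧I (cut C c (∧E₁ ax)) (cut C c′ (∧E₂ ax))
factor-≡ (∧E₁ d) C N e = factor-map C ∧E₁ (factor-≡ d C N e)
factor-≡ (∧E₂ d) C N e = factor-map C ∧E₂ (factor-≡ d C N e)
factor-≡ (∨I₁ d) C N e = factor-map C ∨I₁ (factor-≡ d C N e)
factor-≡ (∨I₂ d) C N e = factor-map C ∨I₂ (factor-≡ d C N e)
factor-≡ (dist d) C N e = factor-map C dist (factor-≡ d C N e)
factor-≡ (ƛI {σ = σ} l d) (ƛ C) N refl
  with α , n , c ← factor-≡ d (subC (inst (hyp σ)) C) N (sub-plug _ C N) =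
  α , n , ƛI (trans (cnt-plug zero C (hyp α) N) l) (⊩-≡ (sym (sub-plug _ C (hyp α))) c)
factor-≡ (·E d e) (C ◃ u) N refl with α , n , c ← factor-≡ d C N refl = α , n , ·E c e
factor-≡ (·E d e) (t ▹ C) N refl with α , n , c ← factor-≡ e C N refl = α , n , ·E d c
factor-≡ (split {σ} {τ} D B d d′ b) C N e with overlap-view C D (sym e)
-- `N` lies inside the subject, so only the typing of the subject is factored.
... | inner E refl p with α , n , c ← factor-≡ b E N refl =
  α , n , ⊩-≡ (sym (p (hyp α))) (split D (E ⟦ hyp α ⟧) d d′ c)
-- The subject lies inside `N`, whose type depends on the case: `N` gets the union, and the context
-- distinguishes cases again.
... | outer E refl p
  with α  , n  , c  ← factor-≡ d  C (E ⟦ hyp σ ⟧) (p (hyp σ))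
     | α′ , n′ , c′ ← factor-≡ d′ C (E ⟦ hyp τ ⟧) (p (hyp τ)) =
  α ∨ α′ , split E B (∨I₁ n) (∨I₂ n′) b , split C (hyp (α ∨ α′)) c c′ ax
-- Disjoint positions: both branches type `N`, and the case distinction on `B` is redone with a leaf
-- in place of `N`.
... | apart C′ D′ p q r
  with α  , n  , c  ← factor-≡ d  (C′ (hyp σ)) N (trans (r (hyp σ)) (sym (p N (hyp σ))))
     | α′ , n′ , c′ ← factor-≡ d′ (C′ (hyp τ)) N (trans (r (hyp τ)) (sym (p N (hyp τ)))) =
  α ∧ α′ , ∧I n n′ ,
  ⊩-≡ (trans (sym (p h B)) (sym (q h)))
    (split (D′ h) B (⊩-≡ (p h (hyp σ)) (cut (C′ (hyp σ)) c (∧E₁ ax)))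
                    (⊩-≡ (p h (hyp τ)) (cut (C′ (hyp τ)) c′ (∧E₂ ax))) b)
  where h = hyp (α ∧ α′)

factor : ∀ C {N ρ} → C ⟦ N ⟧ ⊩ ρ → Factor C N ρ
factor C d = factor-≡ d C _ refl

-- Canonical typings of abstractions

-- A type read as a propositional formula over its outermost atoms and arrows, valued by `A`.
Holds : (Ty → Set) → Ty → Set
Holds A (atom a) = A (atom a)
Holds A (σ ⇒ τ)  = A (σ ⇒ τ)
Holds A (σ ∧ τ)  = Holds A σ × Holds A τ
Holds A (σ ∨ τ)  = Holds A σ ⊎ Holds A τ

Holds⇒⊩ : ∀ {A t} → (∀ {ρ} → A ρ → t ⊩ ρ) → ∀ ρ → Holds A ρ → t ⊩ ρ
Holds⇒⊩ f (atom a) h        = f h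
Holds⇒⊩ f (σ ⇒ τ)  h        = f h
Holds⇒⊩ f (σ ∧ τ)  (h , h′) = ∧I (Holds⇒⊩ f σ h) (Holds⇒⊩ f τ h′)
Holds⇒⊩ f (σ ∨ τ)  (inj₁ h) = ∨I₁ (Holds⇒⊩ f σ h)
Holds⇒⊩ f (σ ∨ τ)  (inj₂ h) = ∨I₂ (Holds⇒⊩ f τ h)

wk≡hyp : ∀ {n} N {α} → wk {n} N ≡ hyp α → N ≡ hyp α
wk≡hyp (hyp α) refl = refl

plug≡hyp : ∀ (C : Ctx 0) N {α} → C ⟦ N ⟧ ≡ hyp α → C ≡ hole × N ≡ hyp α
plug≡hyp hole N e = refl , wk≡hyp N e

-- A leaf has only the types that follow propositionally from its own: its derivation cannot end
-- with an arrow rule, and a case distinction in it must be on the whole leaf.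
hyp-sound-≡ : ∀ {A t α ρ} → t ⊩ ρ → t ≡ hyp α → Holds A α → Holds A ρ
hyp-sound-≡ ax        refl v = v
hyp-sound-≡ (∧I d e)  p    v = hyp-sound-≡ d p v , hyp-sound-≡ e p v
hyp-sound-≡ (∧E₁ d)   p    v = proj₁ (hyp-sound-≡ d p v)
hyp-sound-≡ (∧E₂ d)   p    v = proj₂ (hyp-sound-≡ d p v)
hyp-sound-≡ (∨I₁ d)   p    v = inj₁ (hyp-sound-≡ d p v)
hyp-sound-≡ (∨I₂ d)   p    v = inj₂ (hyp-sound-≡ d p v)
hyp-sound-≡ (dist d)  p    v with hyp-sound-≡ d p v
... | inj₁ x , z = inj₁ (x , z)
... | inj₂ y , z = inj₂ (y , z)
hyp-sound-≡ (split C N d d′ e) p v with refl , refl ← plug≡hyp C N p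
  with hyp-sound-≡ e refl v
... | inj₁ x = hyp-sound-≡ d refl x
... | inj₂ y = hyp-sound-≡ d′ refl y

hyp-sound : ∀ {A α ρ} → hyp α ⊩ ρ → Holds A α → Holds A ρ
hyp-sound d = hyp-sound-≡ d refl

data Prime : Ty → Set where
  atom : ∀ {a} → Prime (atom a)
  _⇒_  : ∀ σ τ → Prime (σ ⇒ τ)
  _∧_  : ∀ {σ τ} → Prime σ → Prime τ → Prime (σ ∧ τ)

-- A prime type has no outer union, so no side has to be chosen.
prime-Holds : ∀ {t π} → Prime π → t ⊩ π → Holds (t ⊩_) π
prime-Holds atom    d = d
prime-Holds (σ ⇒ τ) d = d
prime-Holds (p ∧ q) d = prime-Holds p (∧E₁ d) , prime-Holds q (∧E₂ d)

-- Derivability from `hyp π` is a valuation in which `π` holds, hence `σ ∨ τ` holds too, and this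
-- names a side.
prime-∨ : ∀ {π σ τ} → Prime π → hyp π ⊩ σ ∨ τ → hyp π ⊩ σ ⊎ hyp π ⊩ τ
prime-∨ {σ = σ} {τ} p d with hyp-sound d (prime-Holds p ax)
... | inj₁ h = inj₁ (Holds⇒⊩ id σ h)
... | inj₂ h = inj₂ (Holds⇒⊩ id τ h)

ArrowOf : Tm 1 → Ty → Set
ArrowOf P (σ ⇒ τ) = cnt zero P ≡ 1 × P ⟨ hyp σ ⟩ ⊩ τ
ArrowOf P _       = ⊥

ArrowOf⇒⊩ : ∀ {P ρ} → ArrowOf P ρ → ƛ P ⊩ ρ
ArrowOf⇒⊩ {ρ = σ ⇒ τ} (l , d) = ƛI l d

-- Canonical typing of `ƛ P`: an arrow holds when it is introduced directly from the body, an atom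
-- never.
V : Tm 1 → Ty → Set
V P = Holds (ArrowOf P)

V⇒linear : ∀ {P} ρ → V P ρ → cnt zero P ≡ 1
V⇒linear (σ ⇒ τ) (l , _)  = l
V⇒linear (σ ∧ τ) (v , _)  = V⇒linear σ v
V⇒linear (σ ∨ τ) (inj₁ v) = V⇒linear σ v
V⇒linear (σ ∨ τ) (inj₂ v) = V⇒linear τ v

-- Refinements, canonicity of abstractions, and application.

Closed : ∀ {n} → Tm n → Set
Closed t = ∃[ N ] t ≡ wk N

infix 4 _◁_ _⊏_

-- t ◁ u: t refines the leaves of u to leaves of prime type or to canonically typed abstractions, and
-- every closed subterm of t is such a leaf or an abstraction, so that no closed subterm is neutral.
data _◁_ : ∀ {n} → Tm n → Tm n → Set where
  prime : ∀ {n π α} → Prime π → hyp π ⊩ α → hyp {n} π ◁ hyp α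
  abs   : ∀ {n P α} {t : Tm n} → V P α → t ≡ wk (ƛ P) → t ◁ hyp α
  var   : ∀ {n} {i : Fin n} → var i ◁ var i
  ƛ     : ∀ {n} {t u : Tm (suc n)} → t ◁ u → ƛ t ◁ ƛ u
  app   : ∀ {n} {t t′ u u′ : Tm n} → ¬ Closed (t · t′) → t ◁ u → t′ ◁ u′ → t · t′ ◁ u · u′

◁-ren⁻¹ : ∀ {m n} (ρ : Fin m → Fin n) t {t′} → t′ ◁ ren ρ t → ∃[ s ] t′ ≡ ren ρ s × s ◁ t
◁-ren⁻¹ ρ (var i) var          = var i , refl , var
◁-ren⁻¹ ρ (hyp α) (prime p d)  = _ , refl , prime p d
◁-ren⁻¹ ρ (hyp α) (abs {P = P} v refl) = wk (ƛ P) , sym (ren-wk ρ (ƛ P)) , abs v refl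
◁-ren⁻¹ ρ (ƛ t)   (ƛ r) with s , refl , r′ ← ◁-ren⁻¹ (extᵣ ρ) t r = ƛ s , refl , ƛ r′
◁-ren⁻¹ ρ (t · u) (app ¬c r q)
  with s , refl , r′ ← ◁-ren⁻¹ ρ t r | v , refl , q′ ← ◁-ren⁻¹ ρ u q =
  s · v , refl , app (λ (N , e) → ¬c (N , trans (cong (ren ρ) e) (ren-wk ρ N))) r′ q′

◁-split-closed : ∀ {n} N {s σ τ} → s ◁ N → N ⊩ σ ∨ τ →
                 (∀ {P′ P} → N ≡ ƛ P → P′ ◁ P → V P′ (σ ∨ τ)) →
                 wk {n} s ◁ hyp σ ⊎ wk {n} s ◁ hyp τ
◁-split-closed (hyp α) (prime p e) d canon with prime-∨ p (cut hole d e)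
... | inj₁ x = inj₁ (prime p x)
... | inj₂ y = inj₂ (prime p y)
◁-split-closed (hyp α) (abs v refl) d canon with hyp-sound d v
... | inj₁ x = inj₁ (abs x (ren-wk _ _))
... | inj₂ y = inj₂ (abs y (ren-wk _ _))
◁-split-closed (ƛ P) (ƛ r) d canon with canon refl r
... | inj₁ x = inj₁ (abs x refl)
... | inj₂ y = inj₂ (abs y refl)
-- In scope 0 every term is closed, which rules out an application.
◁-split-closed (t · u) (app ¬c r q) d canon = ⊥-elim (¬c (_ , sym (wk-id _)))

-- A refined term has already decided each case distinction in it, so it refines one of the
-- branches. `canon` is the induction hypothesis of `canonical-≡` for the derivation of `N`.
◁-split : ∀ {n} (C : Ctx n) {N t′ σ τ} → t′ ◁ C ⟦ N ⟧ → N ⊩ σ ∨ τ →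
          (∀ {P′ P} → N ≡ ƛ P → P′ ◁ P → V P′ (σ ∨ τ)) →
          t′ ◁ C ⟦ hyp σ ⟧ ⊎ t′ ◁ C ⟦ hyp τ ⟧
◁-split hole {N} r d canon with s , refl , r′ ← ◁-ren⁻¹ _ N r = ◁-split-closed N r′ d canon
◁-split (C ◃ u) (app ¬c r q) d canon with ◁-split C r d canon
... | inj₁ x = inj₁ (app ¬c x q)
... | inj₂ y = inj₂ (app ¬c y q)
◁-split (t ▹ C) (app ¬c r q) d canon with ◁-split C q d canon
... | inj₁ x = inj₁ (app ¬c r x)
... | inj₂ y = inj₂ (app ¬c r y)
◁-split (ƛ C) (ƛ r) d canon with ◁-split C r d canon
... | inj₁ x = inj₁ (ƛ x)
... | inj₂ y = inj₂ (ƛ y)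

data _⊏_ {n} : Tm n → Tm n → Set where
  fill : ∀ C {N α} → N ⊩ α → C ⟦ hyp α ⟧ ⊏ C ⟦ N ⟧

⊏-sub : ∀ {m n} (σ : Fin m → Tm n) {t u} → t ⊏ u → sub σ t ⊏ sub σ u
⊏-sub σ (fill C {N} {α} d) =
  subst₂ _⊏_ (sym (sub-plug σ C (hyp α))) (sym (sub-plug σ C N)) (fill (subC σ C) d)

⊏*-cnt : ∀ {n} (i : Fin n) {t u} → Star _⊏_ t u → cnt i t ≡ cnt i u
⊏*-cnt i ε                    = refl
⊏*-cnt i (fill C {N} _ ◅ rs) = trans (cnt-plug i C _ N) (⊏*-cnt i rs)

⊏*-⊩ : ∀ {t u ρ} → Star _⊏_ t u → t ⊩ ρ → u ⊩ ρ
⊏*-⊩ ε                d = d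
⊏*-⊩ (fill C e ◅ rs) d = ⊏*-⊩ rs (cut C d e)

-- The two relations point in opposite directions: typings pass from left to right along `⊏`, hence
-- from a term to its refinement.
◁⇒⊏* : ∀ {n} {t u : Tm n} → t ◁ u → Star _⊏_ u t
◁⇒⊏* (prime p d)              = fill hole d ◅ ε
◁⇒⊏* (abs {α = α} v refl)     = fill hole (Holds⇒⊩ ArrowOf⇒⊩ α v) ◅ ε
◁⇒⊏* var                      = ε
◁⇒⊏* (ƛ r)                    = gmap ƛ (λ { (fill C d) → fill (ƛ C) d }) (◁⇒⊏* r)
◁⇒⊏* (app {t = t} {u′ = u′} _ r q) =
  gmap (_· u′) (λ { (fill C d) → fill (C ◃ u′) d }) (◁⇒⊏* r) ◅◅
  gmap (t ·_) (λ { (fill C d) → fill (t ▹ C) d }) (◁⇒⊏* q)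

-- Proved for all refinements `P′`: at a case distinction in the body, `P` changes to a branch while
-- the same `P′` refines it.
canonical-≡ : ∀ {t ψ P P′} → t ⊩ ψ → t ≡ ƛ P → P′ ◁ P → V P′ ψ
canonical-≡ (ƛI {σ = σ} l d) refl r =
  trans (sym (⊏*-cnt zero (◁⇒⊏* r))) l , ⊏*-⊩ (gmap (sub _) (⊏-sub _) (◁⇒⊏* r)) d
canonical-≡ (∧I d e) p r = canonical-≡ d p r , canonical-≡ e p r
canonical-≡ (∧E₁ d)  p r = proj₁ (canonical-≡ d p r)
canonical-≡ (∧E₂ d)  p r = proj₂ (canonical-≡ d p r)
canonical-≡ (∨I₁ d)  p r = inj₁ (canonical-≡ d p r)
canonical-≡ (∨I₂ d)  p r = inj₂ (canonical-≡ d p r)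
canonical-≡ (dist d) p r with canonical-≡ d p r
... | inj₁ x , z = inj₁ (x , z)
... | inj₂ y , z = inj₂ (y , z)
-- Here the abstraction itself is the subject; the side that holds selects the branch, which is a
-- typing of a leaf.
canonical-≡ (split hole N d d′ e) p r with canonical-≡ e (trans (sym (wk-id N)) p) r
... | inj₁ x = hyp-sound d x
... | inj₂ y = hyp-sound d′ y
canonical-≡ (split (ƛ C) N d d′ e) refl r with ◁-split C r e (canonical-≡ e)
... | inj₁ x = canonical-≡ d refl x
... | inj₂ y = canonical-≡ d′ refl y

canonical : ∀ {P P′ ψ} → P′ ◁ P → ƛ P ⊩ ψ → V P′ ψ
canonical r d = canonical-≡ d refl r

-- The leaf `hyp α` stands for `ƛ P`, whose canonical typing supplies a typing of the body for each
-- arrow that the application uses.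
apply-≡ : ∀ {t α P Q ρ} → t ⊩ ρ → t ≡ hyp α · Q → V P α → P ⟨ Q ⟩ ⊩ ρ
apply-≡ {P = P} {Q} (·E {σ = σ} d e) refl v with l , b ← hyp-sound d v
  with C , p ← linear-plug P l hole =
  ⊩-≡ (trans (sym (p Q)) (cong (P ⟨_⟩) (wk-id Q))) (cut C (⊩-≡ (p (hyp σ)) b) e)
apply-≡ (∧I d e) p v = ∧I (apply-≡ d p v) (apply-≡ e p v)
apply-≡ (∧E₁ d)  p v = ∧E₁ (apply-≡ d p v)
apply-≡ (∧E₂ d)  p v = ∧E₂ (apply-≡ d p v)
apply-≡ (∨I₁ d)  p v = ∨I₁ (apply-≡ d p v)
apply-≡ (∨I₂ d)  p v = ∨I₂ (apply-≡ d p v)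
apply-≡ (dist d) p v = dist (apply-≡ d p v)
apply-≡ (split hole N d d′ e) p v =
  ⊩-≡ (wk-id _) (split hole _ d d′ (apply-≡ e (trans (sym (wk-id N)) p) v))
-- A case distinction in the operator is on the leaf itself, and `V P α` decides it.
apply-≡ (split (C ◃ u) N d d′ e) p v with q , refl ← ·-injective p
  with refl , refl ← plug≡hyp C N q
  with hyp-sound e v
... | inj₁ x = apply-≡ d refl x
... | inj₂ y = apply-≡ d′ refl y
-- A case distinction in the argument moves to the reduct, where linearity of `P` keeps its subject
-- at one position.
apply-≡ {α = α} {P} (split (t ▹ C) N d d′ e) refl v
  with D , p ← linear-plug P (V⇒linear α v) C =
  ⊩-≡ (sym (p N)) (split D N (⊩-≡ (p _) (apply-≡ d refl v)) (⊩-≡ (p _) (apply-≡ d′ refl v)) e)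

apply : ∀ {α P Q ρ} → V P α → hyp α · Q ⊩ ρ → P ⟨ Q ⟩ ⊩ ρ
apply v d = apply-≡ d refl v

-- Induction over the primes below `α`: by distributivity, a type is a union of primes up to
-- entailment.
prime-cover : ∀ α {Ψ : Ty → Set} → (∀ {β γ} → hyp β ⊩ γ → Ψ γ → Ψ β) →
              (∀ {σ τ} → Ψ σ → Ψ τ → Ψ (σ ∨ τ)) →
              (∀ {π} → Prime π → hyp π ⊩ α → Ψ π) → Ψ α
prime-cover (atom a) down join h = h atom ax
prime-cover (σ ⇒ τ)  down join h = h (σ ⇒ τ) ax
prime-cover (σ ∨ τ)  down join h =
  join (prime-cover σ down join (λ p d → h p (∨I₁ d)))
       (prime-cover τ down join (λ p d → h p (∨I₂ d)))
prime-cover (σ ∧ τ) {Ψ} down join h =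
  prime-cover σ {λ β → Ψ (β ∧ τ)} down∧ join∧ λ {π} p d →
  -- The factors are exchanged so that the one to be decomposed is again on the left.
  down (∧I (∧E₂ ax) (∧E₁ ax)) (prime-cover τ {λ β → Ψ (β ∧ π)} down∧ join∧ λ q e →
  h (q ∧ p) (∧I (cut hole d (∧E₂ ax)) (cut hole e (∧E₁ ax))))
  where
  down∧ : ∀ {θ β γ} → hyp β ⊩ γ → Ψ (γ ∧ θ) → Ψ (β ∧ θ)
  down∧ d = down (∧I (cut hole d (∧E₁ ax)) (∧E₂ ax))
  join∧ : ∀ {θ β γ} → Ψ (β ∧ θ) → Ψ (γ ∧ θ) → Ψ ((β ∨ γ) ∧ θ)
  -- Here `dist` carries the fixed factor `θ` into both sides of the union.
  join∧ x y = down (dist ax) (join x y)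

-- `K` surrounds `N` before a reduction and `K′` after it. Typing `K ⟦ N ⟧` yields one type of `N`,
-- and the case distinctions that split it into primes are made in `K′`.
cover : ∀ K K′ {N ψ ρ} → K ⟦ N ⟧ ⊩ ψ →
        (∀ {π} → Prime π → K ⟦ hyp π ⟧ ⊩ ψ → K′ ⟦ hyp π ⟧ ⊩ ρ) → K′ ⟦ N ⟧ ⊩ ρ
cover K K′ {ρ = ρ} d h with α , n , c ← factor K d =
  cut K′ (prime-cover α {λ β → K′ ⟦ hyp β ⟧ ⊩ ρ} (λ e x → cut K′ x e)
            (λ x y → split K′ _ x y ax) (λ p e → h p (cut K c e))) n

-- Trees of prime replacements, and contraction of a redex.

NotAbs : Tm 0 → Set
NotAbs N = ∀ P → N ≢ ƛ P

-- A term from which a self-refining one is reached by replacing closed subterms that are not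
-- abstractions by arbitrary prime leaves.
data Tree : ∀ {n} → Tm n → Set where
  done : ∀ {n} {t : Tm n} → t ◁ t → Tree t
  node : ∀ {n} {t : Tm n} C N → NotAbs N → t ≡ C ⟦ N ⟧ →
         (∀ {π} → Prime π → Tree (C ⟦ hyp π ⟧)) → Tree t

ren-image? : ∀ {m n} {ρ : Fin m → Fin n} → (∀ i → Dec (∃[ j ] i ≡ ρ j)) →
             ∀ t → Dec (∃[ s ] t ≡ ren ρ s)
ren-image? {ρ = ρ} im (var i) with im i
... | yes (j , e) = yes (var j , cong var e)
... | no ¬p       = no λ { (var j , refl) → ¬p (j , refl) }
ren-image? im (hyp α) = yes (hyp α , refl)
ren-image? {ρ = ρ} im (ƛ t) with ren-image? im′ t
  where
  im′ : ∀ i → Dec (∃[ j ] i ≡ extᵣ ρ j)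
  im′ zero = yes (zero , refl)
  im′ (suc i) with im i
  ... | yes (j , e) = yes (suc j , cong suc e)
  ... | no ¬p       = no λ { (suc j , refl) → ¬p (j , refl) }
... | yes (s , e) = yes (ƛ s , cong ƛ e)
... | no ¬p       = no λ { (ƛ s , refl) → ¬p (s , refl) }
ren-image? im (t · u) with ren-image? im t | ren-image? im u
... | yes (s , e) | yes (v , e′) = yes (s · v , cong₂ _·_ e e′)
... | no ¬p       | _            = no λ { (s · v , refl) → ¬p (s , refl) }
... | yes _       | no ¬p        = no λ { (s · v , refl) → ¬p (v , refl) }

closed? : ∀ {n} (t : Tm n) → Dec (Closed t)
closed? = ren-image? (λ _ → no λ ())

Closed-plug : ∀ {n} (C : Ctx n) {N} M → Closed (C ⟦ N ⟧) → Closed (C ⟦ M ⟧)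
Closed-plug C M (K , e) with E , _ , p ← unplug-wk C K e = E ⟦ M ⟧ , p M

Tree-· : ∀ {n} {t u : Tm n} → Tree t → Tree u → ¬ Closed (t · u) → Tree (t · u)
Tree-· (done r) (done q) ¬c = done (app ¬c r q)
Tree-· {t = t} (done r) (node C N na refl k) ¬c =
  node (t ▹ C) N na refl λ p → Tree-· (done r) (k p) (¬c ∘ Closed-plug (t ▹ C) N)
Tree-· {u = u} (node C N na refl k) U ¬c =
  node (C ◃ u) N na refl λ p → Tree-· (k p) U (¬c ∘ Closed-plug (C ◃ u) N)

Tree-ƛ : ∀ {n} {t : Tm (suc n)} → Tree t → Tree (ƛ t)
Tree-ƛ (done r)             = done (ƛ r)
Tree-ƛ (node C N na refl k) = node (ƛ C) N na refl λ p → Tree-ƛ (k p)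

Tree-closed : ∀ {n} {t : Tm n} N → NotAbs N → t ≡ wk N → Tree t
Tree-closed N na e = node hole N na e λ p → done (prime p ax)

tree : ∀ {n} (t : Tm n) → Tree t
tree (var i) = done var
-- A leaf is replaced too, since its type need not be prime.
tree (hyp α) = Tree-closed (hyp α) (λ _ ()) refl
tree (ƛ t)   = Tree-ƛ (tree t)
tree (t · u) with closed? (t · u)
-- A closed application is replaced as a whole, without entering it.
... | yes (N@(_ · _) , e) = Tree-closed N (λ _ ()) e
... | no ¬c               = Tree-· (tree t) (tree u) ¬c

-- Induction on the tree: a node is replaced in `ƛ P` and in the reduct alike; at `done`, `P`
-- refines itself, so `ƛ P` is typed canonically.
contract : ∀ {P Q α ρ} → Tree P → ƛ P ⊩ α → hyp α · Q ⊩ ρ → P ⟨ Q ⟩ ⊩ ρ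
contract (done r) d e = apply (canonical r d) e
contract {Q = Q} (node C N _ refl k) d e =
  ⊩-≡ (sym (sub-plug _ C N)) (cover (ƛ C) (subC (inst Q) C) d λ {π} p d′ →
    ⊩-≡ (sub-plug _ C (hyp π)) (contract (k p) d′ e))

-- Reduction of scoped terms

cnt-ren : ∀ {m n} {ρ : Fin m → Fin n} i a → (∀ j → δ i (ρ j) ≡ δ a j) →
          ∀ t → cnt i (ren ρ t) ≡ cnt a t
cnt-ren i a h (var j) = h j
cnt-ren i a h (hyp α) = refl
cnt-ren i a h (ƛ t)   = cnt-ren (suc i) (suc a) (λ { zero → refl ; (suc j) → h j }) t
cnt-ren i a h (t · u) = cong₂ _+_ (cnt-ren i a h t) (cnt-ren i a h u)

cnt-ren-ext : ∀ {m n} (ρ : Fin m → Fin n) t → cnt zero (ren (extᵣ ρ) t) ≡ cnt zero t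
cnt-ren-ext ρ = cnt-ren zero zero λ { zero → refl ; (suc j) → refl }

cnt-ren-suc : ∀ {n} (i : Fin n) t → cnt (suc i) (ren suc t) ≡ cnt i t
cnt-ren-suc i = cnt-ren (suc i) i (λ _ → refl)

-- `a` marks the variables whose value yields `i` once, `k` those that yield it `c` times. It is
-- used at a binder, with `c` zero, and at an instantiation.
cnt-sub : ∀ {m n} {σ : Fin m → Tm n} i a k c → (∀ j → cnt i (σ j) ≡ δ a j + δ k j * c) →
          ∀ t → cnt i (sub σ t) ≡ cnt a t + cnt k t * c
cnt-sub i a k c h (var j) = h j
cnt-sub i a k c h (hyp α) = refl
cnt-sub {σ = σ} i a k c h (ƛ t) =
  cnt-sub (suc i) (suc a) (suc k) c
    (λ { zero → refl ; (suc j) → trans (cnt-ren-suc i (σ j)) (h j) }) t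
cnt-sub i a k c h (t · u) = trans (cong₂ _+_ (cnt-sub i a k c h t) (cnt-sub i a k c h u))
  (solve 5 (λ x y z w c → (x :+ y :* c) :+ (z :+ w :* c) := (x :+ z) :+ (y :+ w) :* c) refl
     (cnt a t) (cnt k t) (cnt a u) (cnt k u) c)

cnt-sub-ext : ∀ {m n} (σ : Fin m → Tm n) t → cnt zero (sub (extₛ σ) t) ≡ cnt zero t
cnt-sub-ext σ t = trans (cnt-sub zero zero zero 0 h t) (+0*0 (cnt zero t))
  where
  +0*0 : ∀ x → x + x * 0 ≡ x
  +0*0 x = trans (cong (x +_) (*-zeroʳ x)) (+-identityʳ x)
  h : ∀ j → cnt zero (extₛ σ j) ≡ δ zero j + δ zero j * 0
  h zero    = refl
  h (suc j) = cnt-ren-∉ zero (λ _ → refl) (σ j)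

cnt-inst : ∀ {n} (i : Fin n) P Q → cnt zero P ≡ 1 → cnt i (P ⟨ Q ⟩) ≡ cnt (suc i) P + cnt i Q
cnt-inst i P Q l = trans (cnt-sub i (suc i) zero (cnt i Q) h P)
  (cong (cnt (suc i) P +_) (trans (cong (_* cnt i Q) l) (*-identityˡ _)))
  where
  h : ∀ j → cnt i (inst Q j) ≡ δ (suc i) j + δ zero j * cnt i Q
  h zero    = sym (*-identityˡ _)
  h (suc j) = sym (+-identityʳ _)

LinearTm : ∀ {n} → Tm n → Set
LinearTm (var i) = ⊤
LinearTm (hyp α) = ⊤
LinearTm (ƛ t)   = cnt zero t ≡ 1 × LinearTm t
LinearTm (t · u) = LinearTm t × LinearTm u

LinearTm-sub⁻ : ∀ {m n} (σ : Fin m → Tm n) t → LinearTm (sub σ t) → LinearTm t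
LinearTm-sub⁻ σ (var i) l        = tt
LinearTm-sub⁻ σ (hyp α) l        = tt
LinearTm-sub⁻ σ (ƛ t)   (e , l)  = trans (sym (cnt-sub-ext σ t)) e , LinearTm-sub⁻ (extₛ σ) t l
LinearTm-sub⁻ σ (t · u) (l , l′) = LinearTm-sub⁻ σ t l , LinearTm-sub⁻ σ u l′

LinearTm-ren : ∀ {m n} (ρ : Fin m → Fin n) t → LinearTm t → LinearTm (ren ρ t)
LinearTm-ren ρ (var i) l        = tt
LinearTm-ren ρ (hyp α) l        = tt
LinearTm-ren ρ (ƛ t)   (e , l)  = trans (cnt-ren-ext ρ t) e , LinearTm-ren (extᵣ ρ) t l
LinearTm-ren ρ (t · u) (l , l′) = LinearTm-ren ρ t l , LinearTm-ren ρ u l′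

LinearTm-plug : ∀ {n} (C : Ctx n) {M N} → LinearTm (C ⟦ M ⟧) → LinearTm N → LinearTm (C ⟦ N ⟧)
LinearTm-plug hole    {N = N} l k        = LinearTm-ren _ N k
LinearTm-plug (C ◃ u) (l , l′) k         = LinearTm-plug C l k , l′
LinearTm-plug (t ▹ C) (l , l′) k         = l , LinearTm-plug C l′ k
LinearTm-plug (ƛ C)   {M} {N} (e , l) k  = trans (cnt-plug zero C N M) e , LinearTm-plug C l k

-- `ƛI` demands one occurrence of its variable, and neither instantiating a variable nor filling a
-- hole changes the counts at other binders.
⊩⇒LinearTm : ∀ {t ρ} → t ⊩ ρ → LinearTm t
⊩⇒LinearTm ax                 = tt
⊩⇒LinearTm (ƛI {P} l d)       = l , LinearTm-sub⁻ _ P (⊩⇒LinearTm d)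
⊩⇒LinearTm (·E d e)           = ⊩⇒LinearTm d , ⊩⇒LinearTm e
⊩⇒LinearTm (∧I d e)           = ⊩⇒LinearTm d
⊩⇒LinearTm (∧E₁ d)            = ⊩⇒LinearTm d
⊩⇒LinearTm (∧E₂ d)            = ⊩⇒LinearTm d
⊩⇒LinearTm (∨I₁ d)            = ⊩⇒LinearTm d
⊩⇒LinearTm (∨I₂ d)            = ⊩⇒LinearTm d
⊩⇒LinearTm (dist d)           = ⊩⇒LinearTm d
⊩⇒LinearTm (split C N d d′ e) = LinearTm-plug C (⊩⇒LinearTm d) (⊩⇒LinearTm e)

-- The index bounds the number of binders above the redex.  Contracting below a binder is reduced to
-- contracting in instances of the body, which are not subterms but have a smaller index.
data Step : ∀ {n} → ℕ → Tm n → Tm n → Set where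
  β   : ∀ {n d} {P : Tm (suc n)} {Q} → Step d (ƛ P · Q) (P ⟨ Q ⟩)
  _◃_ : ∀ {n d} {t t′ : Tm n} → Step d t t′ → ∀ u → Step d (t · u) (t′ · u)
  _▹_ : ∀ {n d} t {u u′ : Tm n} → Step d u u′ → Step d (t · u) (t · u′)
  ƛ   : ∀ {n d} {t t′ : Tm (suc n)} → Step d t t′ → Step (suc d) (ƛ t) (ƛ t′)

Step-suc : ∀ {n d} {t t′ : Tm n} → Step d t t′ → Step (suc d) t t′
Step-suc β       = β
Step-suc (s ◃ u) = Step-suc s ◃ u
Step-suc (t ▹ s) = t ▹ Step-suc s
Step-suc (ƛ s)   = ƛ (Step-suc s)

Step-≡ : ∀ {n d} {t u u′ : Tm n} → u ≡ u′ → Step d t u → Step d t u′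
Step-≡ refl s = s

Step-sub : ∀ {m n d} (σ : Fin m → Tm n) {t t′} → Step d t t′ → Step d (sub σ t) (sub σ t′)
Step-sub σ (β {P = P} {Q}) = Step-≡ (sym (sub-inst σ P Q)) β
Step-sub σ (s ◃ u)         = Step-sub σ s ◃ sub σ u
Step-sub σ (t ▹ s)         = sub σ t ▹ Step-sub σ s
Step-sub σ (ƛ s)           = ƛ (Step-sub (extₛ σ) s)

Step-ren⁻¹ : ∀ {m n d} (ρ : Fin m → Fin n) t {u} → Step d (ren ρ t) u →
             ∃[ t′ ] Step d t t′ × u ≡ ren ρ t′
Step-ren⁻¹ ρ (ƛ P · Q) β = P ⟨ Q ⟩ , β , sym (ren-inst ρ P Q)
Step-ren⁻¹ ρ (t · u) (s ◃ _) with t′ , s′ , e ← Step-ren⁻¹ ρ t s = t′ · u , s′ ◃ u , cong (_· _) e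
Step-ren⁻¹ ρ (t · u) (_ ▹ s) with u′ , s′ , e ← Step-ren⁻¹ ρ u s = t · u′ , t ▹ s′ , cong (_ ·_) e
Step-ren⁻¹ ρ (ƛ t) (ƛ s) with t′ , s′ , e ← Step-ren⁻¹ (extᵣ ρ) t s = ƛ t′ , ƛ s′ , cong ƛ e

Step-cnt : ∀ {n d} {t t′ : Tm n} i → LinearTm t → Step d t t′ → cnt i t′ ≡ cnt i t
Step-cnt i ((l , _) , _) (β {P = P} {Q}) = cnt-inst i P Q l
Step-cnt i (l , _) (s ◃ u) = cong (_+ _) (Step-cnt i l s)
Step-cnt i (_ , l) (t ▹ s) = cong (cnt i t +_) (Step-cnt i l s)
Step-cnt i (_ , l) (ƛ s)   = Step-cnt (suc i) l s

data StepPlug {n} (d : ℕ) (C : Ctx n) (N : Tm 0) (t′ : Tm n) : Set where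
  inside  : ∀ N′ → Step d N N′ → t′ ≡ C ⟦ N′ ⟧ → StepPlug d C N t′
  outside : ∀ C′ → (∀ u → Step d (C ⟦ u ⟧) (C′ ⟦ u ⟧)) → t′ ≡ C′ ⟦ N ⟧ → StepPlug d C N t′

-- Not being an abstraction, `N` is not the operator of the redex; a contraction around `N` keeps it
-- at one position by linearity.
step-plug : ∀ {n d} (C : Ctx n) {N t t′} → NotAbs N → LinearTm t → t ≡ C ⟦ N ⟧ →
            Step d t t′ → StepPlug d C N t′
step-plug hole {N} na l refl s with N′ , s′ , e ← Step-ren⁻¹ _ N s = inside N′ s′ e
step-plug (hole ◃ u) {ƛ P} na l refl β = ⊥-elim (na P refl)
step-plug (ƛ C ◃ u) {N} na l refl β =
  outside (subC (inst u) C) (λ v → Step-≡ (sub-plug _ C v) β) (sub-plug _ C N)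
step-plug (ƛ P ▹ C) {N} na ((l , _) , _) refl β with D , p ← linear-plug P l C =
  outside D (λ u → Step-≡ (p u) β) (p N)
step-plug (C ◃ u) na (l , _) refl (s ◃ _) with step-plug C na l refl s
... | inside N′ s′ e  = inside N′ s′ (cong (_· u) e)
... | outside C′ s′ e = outside (C′ ◃ u) (λ v → s′ v ◃ u) (cong (_· u) e)
step-plug (C ◃ u) {N} na l refl (_▹_ _ {u′ = u′} s) = outside (C ◃ u′) (λ v → C ⟦ v ⟧ ▹ s) refl
step-plug (t ▹ C) na l refl (_◃_ {t′ = t′} s _) = outside (t′ ▹ C) (λ v → s ◃ C ⟦ v ⟧) refl
step-plug (t ▹ C) na (_ , l) refl (_ ▹ s) with step-plug C na l refl s
... | inside N′ s′ e  = inside N′ s′ (cong (t ·_) e)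
... | outside C′ s′ e = outside (t ▹ C′) (λ v → t ▹ s′ v) (cong (t ·_) e)
step-plug (ƛ C) na (_ , l) refl (ƛ s) with step-plug C na l refl s
-- The index is only a bound, so the step inside `N` may be given the larger one.
... | inside N′ s′ e  = inside N′ (Step-suc s′) (cong ƛ e)
... | outside C′ s′ e = outside (ƛ C′) (λ v → ƛ (s′ v)) (cong ƛ e)

-- Preservation of types under scoped reduction.

Preserved : ℕ → Set
Preserved d = ∀ {t t′ ρ} → Step d t t′ → t ⊩ ρ → t′ ⊩ ρ

-- Each arrow of a canonical typing is a typing of an instance of the body, where the step has index
-- `d`.
preserved-V : ∀ {d P P′} → Preserved d → Step d P P′ → LinearTm P → ∀ ρ → V P ρ → V P′ ρ
preserved-V IH s l (σ ⇒ τ)  (e , d)  = trans (Step-cnt zero l s) e , IH (Step-sub _ s) d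
preserved-V IH s l (σ ∧ τ)  (v , w)  = preserved-V IH s l σ v , preserved-V IH s l τ w
preserved-V IH s l (σ ∨ τ)  (inj₁ v) = inj₁ (preserved-V IH s l σ v)
preserved-V IH s l (σ ∨ τ)  (inj₂ v) = inj₂ (preserved-V IH s l τ v)

-- As for contraction, subterms of the body are replaced until the typing is canonical; a step
-- inside such a subterm preserves the type it was factored through.
preserved-ƛ : ∀ {d P P′ ψ} → Preserved d → Tree P → Step d P P′ → ƛ P ⊩ ψ → ƛ P′ ⊩ ψ
preserved-ƛ {ψ = ψ} IH (done r) s d =
  Holds⇒⊩ ArrowOf⇒⊩ ψ (preserved-V IH s (proj₂ (⊩⇒LinearTm d)) ψ (canonical r d))
preserved-ƛ IH (node C N na refl k) s d with step-plug C na (proj₂ (⊩⇒LinearTm d)) refl s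
... | inside N′ s′ refl with α , n , c ← factor (ƛ C) d = cut (ƛ C) c (IH s′ n)
... | outside C′ s′ refl =
  cover (ƛ C) (ƛ C′) d λ {π} p d′ → preserved-ƛ IH (k p) (s′ (hyp π)) d′

preserved : ∀ d → Preserved d
preserved d (β {P = P} {Q}) D
  -- The operator gets a single type `α`, which separates the typing of `ƛ P` from that of its
  -- application.
  with α , n , c ← factor-≡ D (hole ◃ Q) (ƛ P) (cong (_· Q) (sym (wk-id (ƛ P)))) =
  contract (tree P) n c
preserved d (_◃_ {t = t} {t′} s u) D
  with α , n , c ← factor-≡ D (hole ◃ u) t (cong (_· u) (sym (wk-id t))) =
  ⊩-≡ (cong (_· u) (wk-id t′)) (cut (hole ◃ u) c (preserved d s n))
preserved d (_▹_ t {u} {u′} s) D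
  with α , n , c ← factor-≡ D (t ▹ hole) u (cong (t ·_) (sym (wk-id u))) =
  ⊩-≡ (cong (t ·_) (wk-id u′)) (cut (t ▹ hole) c (preserved d s n))
preserved (suc d) (ƛ {t = P} s) D = preserved-ƛ (preserved d) (tree P) s D

-- Named terms and scoped terms

Lc : ℕ → Term → Set
Lc k (bvar j)  = j < k
Lc k (fvar x)  = ⊤
Lc k (lam t)   = Lc (suc k) t
Lc k (app t u) = Lc k t × Lc k u

Lc-mono : ∀ {k l} → k ≤ l → ∀ t → Lc k t → Lc l t
Lc-mono k≤l (bvar j)  j<k      = ≤-trans j<k k≤l
Lc-mono k≤l (fvar x)  _        = tt
Lc-mono k≤l (lam t)   c        = Lc-mono (s≤s k≤l) t c
Lc-mono k≤l (app t u) (c , c′) = Lc-mono k≤l t c , Lc-mono k≤l u c′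

Lc-open⁻ : ∀ k {x} t → Lc k (openAt k (fvar x) t) → Lc (suc k) t
Lc-open⁻ k (bvar j) c with j ≟ k
... | yes refl = ≤-refl
... | no _     = m≤n⇒m≤1+n c
Lc-open⁻ k (fvar x)  c        = tt
Lc-open⁻ k (lam t)   c        = Lc-open⁻ (suc k) t c
Lc-open⁻ k (app t u) (c , c′) = Lc-open⁻ k t c , Lc-open⁻ k u c′

Lc-open : ∀ k {u} t → Lc (suc k) t → Lc 0 u → Lc k (openAt k u t)
Lc-open k {u} (bvar j) c cu with j ≟ k
... | yes _  = Lc-mono z≤n u cu
... | no j≢k = ≤∧≢⇒< (≤-pred c) j≢k
Lc-open k (fvar x)  c        cu = tt
Lc-open k (lam t)   c        cu = Lc-open (suc k) t c cu
Lc-open k (app t s) (c , c′) cu = Lc-open k t c cu , Lc-open k s c′ cu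

Lc-subst : ∀ k {x N} t → Lc k t → Lc 0 N → Lc k (t [ N / x ])
Lc-subst k (bvar j) c cN = c
Lc-subst k {x} {N} (fvar y) c cN with y ≟ x
... | yes _ = Lc-mono z≤n N cN
... | no _  = tt
Lc-subst k (lam t)   c        cN = Lc-subst (suc k) t c cN
Lc-subst k (app t s) (c , c′) cN = Lc-subst k t c cN , Lc-subst k s c′ cN

⊢⇒Lc : ∀ {Γ M σ} → Γ ⊢ M ∶ σ → Lc 0 M
⊢⇒Lc Ax                 = tt
⊢⇒Lc (⇒I {M = M} _ _ _ d) = Lc-open⁻ 0 M (⊢⇒Lc d)
⊢⇒Lc (⇒E _ d e)         = ⊢⇒Lc d , ⊢⇒Lc e
⊢⇒Lc (∧I d e)           = ⊢⇒Lc d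
⊢⇒Lc (∧E₁ d)            = ⊢⇒Lc d
⊢⇒Lc (∧E₂ d)            = ⊢⇒Lc d
⊢⇒Lc (∨I₁ d)            = ⊢⇒Lc d
⊢⇒Lc (∨I₂ d)            = ⊢⇒Lc d
⊢⇒Lc (∨E {M = M} _ _ _ d d′ e) = Lc-subst 0 M (⊢⇒Lc d) (⊢⇒Lc e)

⟶-Lc : ∀ {M N} → M ⟶β N → Lc 0 M → Lc 0 N
⟶-Lc (β {t}) (c , c′)            = Lc-open 0 t c c′
⟶-Lc (appL s) (c , c′)           = ⟶-Lc s c , c′
⟶-Lc (appR s) (c , c′)           = c , ⟶-Lc s c′
⟶-Lc (ξ {t} {t′} x _ _ s) c      = Lc-open⁻ 0 t′ (⟶-Lc s (Lc-open 0 t c tt))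

-- Translation of named terms and of their reductions.

upd : ∀ {A : Set} → (ℕ → A) → ℕ → A → ℕ → A
upd f x a y with y ≟ x
... | yes _ = a
... | no _  = f y

upd-same : ∀ {A : Set} (f : ℕ → A) x {a} → upd f x a x ≡ a
upd-same f x with x ≟ x
... | yes _ = refl
... | no ¬p = ⊥-elim (¬p refl)

upd-other : ∀ {A : Set} (f : ℕ → A) x {a} y → y ≢ x → upd f x a y ≡ f y
upd-other f x y y≢x with y ≟ x
... | yes p = ⊥-elim (y≢x p)
... | no _  = refl

extb : ∀ {n} → (ℕ → Tm n) → ℕ → Tm (suc n)
extb b zero    = var zero
extb b (suc j) = ren suc (b j)

-- b gives the values of dangling indices; it is irrelevant for locally closed terms.
ann : ∀ {n} → (ℕ → Tm n) → (ℕ → Tm n) → Term → Tm n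
ann b f (bvar j)  = b j
ann b f (fvar x)  = f x
ann b f (lam t)   = ƛ (ann (extb b) (ren suc ∘ f) t)
ann b f (app t u) = ann b f t · ann b f u

∉-++⁻ : ∀ {x : ℕ} {xs ys} → x ∉ xs ++ ys → x ∉ xs × x ∉ ys
∉-++⁻ {xs = xs} h = h ∘ ∈-++⁺ˡ , h ∘ ∈-++⁺ʳ xs

ann-cong : ∀ {n k} {b b′ f f′ : ℕ → Tm n} t → Lc k t → (∀ j → j < k → b j ≡ b′ j) →
           (∀ x → x ∈ fv t → f x ≡ f′ x) → ann b f t ≡ ann b′ f′ t
ann-cong (bvar j) c p q = p j c
ann-cong (fvar x) c p q = q x (here refl)
ann-cong (lam t)  c p q =
  cong ƛ (ann-cong t c (λ { zero _ → refl ; (suc j) (s≤s l) → cong (ren suc) (p j l) })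
                     (λ x m → cong (ren suc) (q x m)))
ann-cong (app t u) (c , c′) p q =
  cong₂ _·_ (ann-cong t c p (λ x → q x ∘ ∈-++⁺ˡ)) (ann-cong u c′ p (λ x → q x ∘ ∈-++⁺ʳ (fv t)))

ann-ren : ∀ {m n} {ρ : Fin m → Fin n} {b f b′ f′} → (∀ j → ren ρ (b j) ≡ b′ j) →
          (∀ x → ren ρ (f x) ≡ f′ x) → ∀ t → ren ρ (ann b f t) ≡ ann b′ f′ t
ann-ren p q (bvar j) = p j
ann-ren p q (fvar x) = q x
ann-ren {b = b} {f} p q (lam t) = cong ƛ (ann-ren
  (λ { zero → refl ; (suc j) → trans (ren-ext-suc (b j)) (cong (ren suc) (p j)) })
  (λ x → trans (ren-ext-suc (f x)) (cong (ren suc) (q x))) t)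
ann-ren p q (app t u) = cong₂ _·_ (ann-ren p q t) (ann-ren p q u)

ann-sub : ∀ {m n} {σ : Fin m → Tm n} {b f b′ f′} → (∀ j → sub σ (b j) ≡ b′ j) →
          (∀ x → sub σ (f x) ≡ f′ x) → ∀ t → sub σ (ann b f t) ≡ ann b′ f′ t
ann-sub p q (bvar j) = p j
ann-sub p q (fvar x) = q x
ann-sub {b = b} {f} p q (lam t) = cong ƛ (ann-sub
  (λ { zero → refl ; (suc j) → trans (sub-ext-suc (b j)) (cong (ren suc) (p j)) })
  (λ x → trans (sub-ext-suc (f x)) (cong (ren suc) (q x))) t)
ann-sub p q (app t u) = cong₂ _·_ (ann-sub p q t) (ann-sub p q u)

ann-closed-suc : ∀ {n} {b f : ℕ → Tm n} {b′ : ℕ → Tm (suc n)} u → Lc 0 u →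
                 ann b′ (ren suc ∘ f) u ≡ ren suc (ann b f u)
ann-closed-suc u c =
  sym (trans (ann-ren (λ _ → refl) (λ _ → refl) u) (ann-cong u c (λ _ ()) (λ _ _ → refl)))

-- Opening changes only what index `k` means, so the assignment of indices absorbs it.
ann-open : ∀ {n} {b b′ f : ℕ → Tm n} {u} → Lc 0 u → ∀ k t → b′ k ≡ ann b f u →
           (∀ j → j ≢ k → b′ j ≡ b j) → ann b f (openAt k u t) ≡ ann b′ f t
ann-open c k (bvar j) p q with j ≟ k
... | yes refl = sym p
... | no j≢k   = sym (q j j≢k)
ann-open c k (fvar x) p q = refl
ann-open {u = u} c k (lam t) p q = cong ƛ (ann-open c (suc k) t
  (trans (cong (ren suc) p) (sym (ann-closed-suc u c)))
  (λ { zero _ → refl ; (suc j) j≢k → cong (ren suc) (q j (j≢k ∘ cong suc)) }))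
ann-open c k (app t s) p q = cong₂ _·_ (ann-open c k t p q) (ann-open c k s p q)

ann-^ : ∀ {n} {b f : ℕ → Tm n} t {u} → Lc 1 t → Lc 0 u →
        ann b f (t ^ u) ≡ ann (extb b) (ren suc ∘ f) t ⟨ ann b f u ⟩
ann-^ {b = b} {f} t {u} ct cu =
  trans (ann-open {b′ = upd b 0 (ann b f u)} cu 0 t (upd-same b 0) (upd-other b 0))
  (trans (ann-cong t ct (λ { zero _ → refl ; (suc _) (s≤s ()) }) (λ _ _ → refl))
         (sym (ann-sub {b′ = λ { zero → ann b f u ; (suc j) → b j }}
                (λ { zero → refl ; (suc j) → inst-suc _ (b j) }) (λ x → inst-suc _ (f x)) t)))

-- Reading the fresh name as `var zero` recovers the scoped body, which turns the premise of `ξ`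
-- into a step under `ƛ`.
ann-^-var : ∀ {n} {b f : ℕ → Tm n} x t → x ∉ fv t → Lc 1 t →
            ann (ren suc ∘ b) (upd (ren suc ∘ f) x (var zero)) (t ^ fvar x) ≡
            ann (extb b) (ren suc ∘ f) t
ann-^-var {b = b} {f} x t x∉ c =
  trans (ann-open {b′ = upd (ren suc ∘ b) 0 (var zero)} {u = fvar x} tt 0 t
           (sym (upd-same _ x)) (upd-other _ 0))
        (ann-cong t c (λ { zero _ → refl ; (suc _) (s≤s ()) })
           λ y y∈ → upd-other _ x y λ { refl → x∉ y∈ })

-- The index counts the uses of `ξ` around the redex. All assignments are allowed because `ξ` reads
-- its fresh name as a bound variable.
⟶-Step : ∀ {M N} → M ⟶β N → Lc 0 M →
         ∃[ d ] ∀ {n} (b f : ℕ → Tm n) → Step d (ann b f M) (ann b f N)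

⟶-Step-body : ∀ {x} t t′ → x ∉ fv t → x ∉ fv t′ → (t ^ fvar x) ⟶β (t′ ^ fvar x) → Lc 1 t →
              ∃[ d ] ∀ {n} (b f : ℕ → Tm n) →
              Step d (ann (extb b) (ren suc ∘ f) t) (ann (extb b) (ren suc ∘ f) t′)

⟶-Step (β {t} {u}) (c , c′) = 0 , λ b f → Step-≡ (sym (ann-^ t c c′)) β
⟶-Step (appL {u = u} s) (c , _) with d , h ← ⟶-Step s c = d , λ b f → h b f ◃ ann b f u
⟶-Step (appR {t} s) (_ , c) with d , h ← ⟶-Step s c = d , λ b f → ann b f t ▹ h b f
⟶-Step (ξ {t} {t′} x x∉ x∉′ s) c with d , h ← ⟶-Step-body t t′ x∉ x∉′ s c =
  suc d , λ b f → ƛ (h b f)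

⟶-Step-body {x} t t′ x∉ x∉′ s c with d , h ← ⟶-Step s (Lc-open 0 t c tt) =
  d , λ b f → subst₂ (Step d) (ann-^-var x t x∉ c) (ann-^-var x t′ x∉′ c′) (h _ _)
  where c′ = Lc-open⁻ 0 t′ (⟶-Lc s (Lc-open 0 t c tt))

-- Occurrences and free variables of named terms.

countB-suc : ∀ k j → countB (suc k) (bvar (suc j)) ≡ countB k (bvar j)
countB-suc k j with j ≟ k | suc j ≟ suc k
... | yes _ | yes _ = refl
... | no _  | no _  = refl
... | yes p | no ¬q = ⊥-elim (¬q (cong suc p))
... | no ¬p | yes q = ⊥-elim (¬p (ℕ-suc-injective q))

cnt-ann : ∀ {n} {b f : ℕ → Tm n} i k → (∀ j → cnt i (b j) ≡ countB k (bvar j)) →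
          (∀ x → cnt i (f x) ≡ 0) → ∀ t → cnt i (ann b f t) ≡ countB k t
cnt-ann i k p q (bvar j) = p j
cnt-ann i k p q (fvar x) = q x
cnt-ann {b = b} {f} i k p q (lam t) = cnt-ann (suc i) (suc k)
  (λ { zero → refl
     ; (suc j) → trans (cnt-ren-suc i (b j)) (trans (p j) (sym (countB-suc k j))) })
  (λ x → trans (cnt-ren-suc i (f x)) (q x)) t
cnt-ann i k p q (app t u) = cong₂ _+_ (cnt-ann i k p q t) (cnt-ann i k p q u)

cnt-ann-body : ∀ {n} (b f : ℕ → Tm n) t → cnt zero (ann (extb b) (ren suc ∘ f) t) ≡ countB 0 t
cnt-ann-body b f = cnt-ann zero 0
  (λ { zero → refl ; (suc j) → cnt-ren-∉ zero (λ _ → refl) (b j) })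
  (λ x → cnt-ren-∉ zero (λ _ → refl) (f x))

open-absent : ∀ k t {u} → countB k t ≡ 0 → openAt k u t ≡ t
open-absent k (bvar j) e with j ≟ k | e
... | no _ | _ = refl
open-absent k (fvar x)  e = refl
open-absent k (lam t)   e = cong lam (open-absent (suc k) t e)
open-absent k (app t s) e with e₁ , e₂ ← +≡0 (countB k t) e =
  cong₂ app (open-absent k t e₁) (open-absent k s e₂)

++-swapʳ : ∀ {A : Set} (xs ys zs : List A) → (xs ++ ys) ++ zs ↭ (xs ++ zs) ++ ys
++-swapʳ xs ys zs = ↭-trans (++-assoc xs ys zs)
                    (↭-trans (++⁺ˡ xs (++-comm ys zs)) (↭-sym (++-assoc xs zs ys)))

fv-open : ∀ k t {u} → countB k t ≡ 1 → fv (openAt k u t) ↭ fv t ++ fv u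
fv-open k (bvar j) e with j ≟ k | e
... | yes _ | _ = ↭-refl
fv-open k (lam t) e = fv-open (suc k) t e
fv-open k (app t s) {u} e with +≡1 (countB k t) e
... | inj₁ (e₁ , e₂) rewrite open-absent k s {u} e₂ =
  ↭-trans (++⁺ʳ (fv s) (fv-open k t e₁)) (++-swapʳ (fv t) (fv u) (fv s))
... | inj₂ (e₁ , e₂) rewrite open-absent k t {u} e₁ =
  ↭-trans (++⁺ˡ (fv t) (fv-open k s e₂)) (↭-sym (++-assoc (fv t) (fv s) (fv u)))

fv-open-var : ∀ t x → countB 0 t ≡ 1 → fv (t ^ fvar x) ↭ x ∷ fv t
fv-open-var t x e = ↭-trans (fv-open 0 t e) (++-comm (fv t) [ x ])

-- When bound variables occur once, contraction neither copies nor erases its argument. Below a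
-- binder, the opened bodies are compared and their common name cancelled.
⟶-fv : ∀ {M N} → M ⟶β N → Lc 0 M → ∀ {n} (b f : ℕ → Tm n) → LinearTm (ann b f M) →
       fv N ↭ fv M
⟶-fv (β {t}) c b f ((e , _) , _) = fv-open 0 t (trans (sym (cnt-ann-body b f t)) e)
⟶-fv (appL {u = u} s) (c , _) b f (l , _) = ++⁺ʳ (fv u) (⟶-fv s c b f l)
⟶-fv (appR {t} s) (_ , c) b f (_ , l) = ++⁺ˡ (fv t) (⟶-fv s c b f l)
⟶-fv (ξ {t} {t′} x x∉ x∉′ s) c b f (e , l)
  with _ , h ← ⟶-Step-body t t′ x∉ x∉′ s c = drop-∷
  (↭-trans (↭-sym (fv-open-var t′ x e′))
  (↭-trans (⟶-fv s (Lc-open 0 t c tt) _ _ (subst LinearTm (sym (ann-^-var x t x∉ c)) l))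
           (fv-open-var t x (trans (sym (cnt-ann-body b f t)) e))))
  where
  e′ : countB 0 t′ ≡ 1
  e′ = trans (sym (cnt-ann-body b f t′)) (trans (Step-cnt zero l (h b f)) e)

occ : ℕ → List ℕ → ℕ
occ x []       = 0
occ x (y ∷ ys) = countF x (fvar y) + occ x ys

occ-++ : ∀ x ys zs → occ x (ys ++ zs) ≡ occ x ys + occ x zs
occ-++ x []       zs = refl
occ-++ x (y ∷ ys) zs = trans (cong (countF x (fvar y) +_) (occ-++ x ys zs))
                             (sym (+-assoc (countF x (fvar y)) _ _))

occ-fv : ∀ x t → occ x (fv t) ≡ countF x t
occ-fv x (bvar j)  = refl
occ-fv x (fvar y)  = +-identityʳ _
occ-fv x (lam t)   = occ-fv x t
occ-fv x (app t u) = trans (occ-++ x (fv t) (fv u)) (cong₂ _+_ (occ-fv x t) (occ-fv x u))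

occ-↭ : ∀ x {ys zs} → ys ↭ zs → occ x ys ≡ occ x zs
occ-↭ x refl         = refl
occ-↭ x (prep y p)   = cong (countF x (fvar y) +_) (occ-↭ x p)
occ-↭ x (swap y z p) = trans (cong (λ w → countF x (fvar y) + (countF x (fvar z) + w)) (occ-↭ x p))
  (solve 3 (λ a b c → a :+ (b :+ c) := b :+ (a :+ c)) refl
    (countF x (fvar y)) (countF x (fvar z)) _)
occ-↭ x (_↭_.trans p q)  = trans (occ-↭ x p) (occ-↭ x q)

countF-self : ∀ x → countF x (fvar x) ≡ 1
countF-self x with x ≟ x
... | yes _ = refl
... | no ¬p = ⊥-elim (¬p refl)

countF-other : ∀ x y → y ≢ x → countF x (fvar y) ≡ 0
countF-other x y y≢x with y ≟ x
... | yes p = ⊥-elim (y≢x p)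
... | no _  = refl

occ-∉ : ∀ x ys → x ∉ ys → occ x ys ≡ 0
occ-∉ x []       h = refl
occ-∉ x (y ∷ ys) h =
  cong₂ _+_ (countF-other x y λ { refl → h (here refl) }) (occ-∉ x ys (h ∘ there))

countF-∉ : ∀ x t → x ∉ fv t → countF x t ≡ 0
countF-∉ x t h = trans (sym (occ-fv x t)) (occ-∉ x (fv t) h)

countF-once : ∀ {x xs} t → x ∉ xs → fv t ↭ x ∷ xs → countF x t ≡ 1
countF-once {x} {xs} t h p =
  trans (sym (occ-fv x t)) (trans (occ-↭ x p) (cong₂ _+_ (countF-self x) (occ-∉ x xs h)))

occ-∈ : ∀ {x ys} → x ∈ ys → 1 ≤ occ x ys
occ-∈ {x} (here refl) rewrite countF-self x = s≤s z≤n
occ-∈ {x} {y ∷ ys} (there m) = ≤-trans (occ-∈ m) (m≤n+m _ (countF x (fvar y)))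

occ≤1⇒Unique : ∀ xs → (∀ x → occ x xs ≤ 1) → Unique xs
occ≤1⇒Unique []       h = []
occ≤1⇒Unique (x ∷ xs) h =
  ¬Any⇒All¬ xs (λ m → 1+n≰n (≤-trans (s≤s (occ-∈ m)) at-x)) ∷
  occ≤1⇒Unique xs (λ y → ≤-trans (m≤n+m _ _) (h y))
  where
  at-x : 1 + occ x xs ≤ 1
  at-x = subst (λ c → c + occ x xs ≤ 1) (countF-self x) (h x)

countF-open : ∀ x k t → x ∉ fv t → countF x (openAt k (fvar x) t) ≡ countB k t
countF-open x k (bvar j) h with j ≟ k
... | yes _ = countF-self x
... | no _  = refl
countF-open x k (fvar y)  h = countF-∉ x (fvar y) h
countF-open x k (lam t)   h = countF-open x (suc k) t h
countF-open x k (app t u) h with h₁ , h₂ ← ∉-++⁻ {xs = fv t} h =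
  cong₂ _+_ (countF-open x k t h₁) (countF-open x k u h₂)

subst-absent : ∀ x t {N} → countF x t ≡ 0 → t [ N / x ] ≡ t
subst-absent x (bvar j) e = refl
subst-absent x (fvar y) e with y ≟ x | e
... | no _ | _ = refl
subst-absent x (lam t)   e = cong lam (subst-absent x t e)
subst-absent x (app t s) e with e₁ , e₂ ← +≡0 (countF x t) e =
  cong₂ app (subst-absent x t e₁) (subst-absent x s e₂)

subst-self : ∀ x {N} → fvar x [ N / x ] ≡ N
subst-self x with x ≟ x
... | yes _ = refl
... | no ¬p = ⊥-elim (¬p refl)

fv-subst : ∀ x t N → countF x t ≡ 1 → ∃[ F ] fv t ↭ x ∷ F × fv (t [ N / x ]) ↭ F ++ fv N
fv-subst x (fvar y) N e with y ≟ x | e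
... | yes refl | _ = [] , ↭-refl , ↭-refl
fv-subst x (lam t) N e = fv-subst x t N e
fv-subst x (app t s) N e with +≡1 (countF x t) e
... | inj₁ (e₁ , e₂) with F , p , q ← fv-subst x t N e₁ rewrite subst-absent x s {N} e₂ =
  F ++ fv s , ++⁺ʳ (fv s) p , ↭-trans (++⁺ʳ (fv s) q) (++-swapʳ F (fv N) (fv s))
... | inj₂ (e₁ , e₂) with F , p , q ← fv-subst x s N e₂ rewrite subst-absent x t {N} e₁ =
  fv t ++ F , ↭-trans (++⁺ˡ (fv t) p) (shift x (fv t) F) ,
  ↭-trans (++⁺ˡ (fv t) q) (↭-sym (++-assoc (fv t) F (fv N)))

-- Domains of environments.

dom-++ : ∀ Γ Δ → dom (Γ ++ Δ) ≡ dom Γ ++ dom Δ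
dom-++ = map-++ proj₁

dom-split : ∀ {Γ} Γ₁ Γ₂ → Γ ↭ Γ₁ ++ Γ₂ → dom Γ ↭ dom Γ₁ ++ dom Γ₂
dom-split Γ₁ Γ₂ p = subst (dom _ ↭_) (dom-++ Γ₁ Γ₂) (map⁺ proj₁ p)

-- There is neither weakening nor contraction. In `⇒I` the bound variable must be seen to occur
-- once, whence the mutual induction with `⊢-countB`.
⊢⇒dom↭fv : ∀ {Γ M σ} → Γ ⊢ M ∶ σ → dom Γ ↭ fv M

⊢-countB : ∀ {Γ x σ τ} M → x ∉ dom Γ → x ∉ fv M → (x , σ) ∷ Γ ⊢ M ^ fvar x ∶ τ → countB 0 M ≡ 1

⊢⇒dom↭fv Ax = ↭-refl
⊢⇒dom↭fv (⇒I {M = M} x h h′ d) =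
  drop-∷ (↭-trans (⊢⇒dom↭fv d) (fv-open-var M x (⊢-countB M h h′ d)))
⊢⇒dom↭fv (⇒E {Γ₁ = Γ₁} {Γ₂} (p , _) d e) =
  ↭-trans (dom-split Γ₁ Γ₂ p) (++⁺ (⊢⇒dom↭fv d) (⊢⇒dom↭fv e))
⊢⇒dom↭fv (∧I d e) = ⊢⇒dom↭fv d
⊢⇒dom↭fv (∧E₁ d)  = ⊢⇒dom↭fv d
⊢⇒dom↭fv (∧E₂ d)  = ⊢⇒dom↭fv d
⊢⇒dom↭fv (∨I₁ d)  = ⊢⇒dom↭fv d
⊢⇒dom↭fv (∨I₂ d)  = ⊢⇒dom↭fv d
⊢⇒dom↭fv (∨E {Γ₁ = Γ₁} {Γ₂} {M} {N} x (p , _) h d d′ e)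
  with F , q , r ← fv-subst x M N (countF-once M h (↭-sym (⊢⇒dom↭fv d))) =
  ↭-trans (dom-split Γ₁ Γ₂ p)
    (↭-trans (++⁺ (drop-∷ (↭-trans (⊢⇒dom↭fv d) q)) (⊢⇒dom↭fv e)) (↭-sym r))

⊢-countB {x = x} M h h′ d =
  trans (sym (countF-open x 0 M h′)) (countF-once (M ^ fvar x) h (↭-sym (⊢⇒dom↭fv d)))

-- From named to scoped typings.

ann-absent : ∀ {n x} {b f f′ : ℕ → Tm n} t → countF x t ≡ 0 → (∀ y → y ≢ x → f y ≡ f′ y) →
             ann b f t ≡ ann b f′ t
ann-absent (bvar j) e p = refl
ann-absent {x = x} (fvar y) e p with y ≟ x | e
... | no y≢x | _ = p y y≢x
ann-absent (lam t) e p = cong ƛ (ann-absent t e (λ y y≢x → cong (ren suc) (p y y≢x)))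
ann-absent (app t u) e p with e₁ , e₂ ← +≡0 (countF _ t) e =
  cong₂ _·_ (ann-absent t e₁ p) (ann-absent u e₂ p)

ann-subst : ∀ {n x N} {b f f′ : ℕ → Tm n} → Lc 0 N → ∀ t → f′ x ≡ ann b f N →
            (∀ y → y ≢ x → f′ y ≡ f y) → ann b f (t [ N / x ]) ≡ ann b f′ t
ann-subst c (bvar j) p q = refl
ann-subst {x = x} c (fvar y) p q with y ≟ x
... | yes refl = sym p
... | no y≢x   = sym (q y y≢x)
ann-subst {N = N} c (lam t) p q = cong ƛ (ann-subst c t
  (trans (cong (ren suc) p) (sym (ann-closed-suc N c))) (λ y y≢x → cong (ren suc) (q y y≢x)))
ann-subst c (app t u) p q = cong₂ _·_ (ann-subst c t p q) (ann-subst c u p q)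

-- The named counterpart of `sub-linear`, for the variable of (∨E).
ann-once : ∀ {n} x (b f : ℕ → Tm n) t → countF x t ≡ 1 →
           ∃[ C ] ∀ {f′} u → f′ x ≡ wk u → (∀ y → y ≢ x → f y ≡ f′ y) → ann b f′ t ≡ C ⟦ u ⟧
ann-once x b f (fvar y) e with y ≟ x | e
... | yes refl | _ = hole , λ u p q → p
ann-once x b f (lam t) e with C , h ← ann-once x (extb b) (ren suc ∘ f) t e =
  ƛ C , λ u p q → cong ƛ (h u (trans (cong (ren suc) p) (ren-wk suc u))
                              (λ y y≢x → cong (ren suc) (q y y≢x)))
ann-once x b f (app t s) e with +≡1 (countF x t) e
... | inj₁ (e₁ , e₂) with C , h ← ann-once x b f t e₁ =
  C ◃ ann b f s , λ u p q → cong₂ _·_ (h u p q) (sym (ann-absent s e₂ q))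
... | inj₂ (e₁ , e₂) with C , h ← ann-once x b f s e₂ =
  ann b f t ▹ C , λ u p q → cong₂ _·_ (sym (ann-absent t e₁ q)) (h u p q)

-- A total assignment replaces the environment, so both premises of `⇒E` can share it.
Consistent : (ℕ → Ty) → Env → Set
Consistent G = All (λ (x , α) → G x ≡ α)

Consistent-upd : ∀ {G Γ x σ} → x ∉ dom Γ → Consistent G Γ → Consistent (upd G x σ) Γ
Consistent-upd x∉ []       = []
Consistent-upd {G} {(y , _) ∷ _} {x} x∉ (p ∷ ps) =
  trans (upd-other G x y λ { refl → x∉ (here refl) }) p ∷ Consistent-upd (x∉ ∘ there) ps

Consistent-∷ : ∀ {G Γ x σ} → x ∉ dom Γ → Consistent G Γ → Consistent (upd G x σ) ((x , σ) ∷ Γ)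
Consistent-∷ {G} {x = x} x∉ ps = upd-same G x ∷ Consistent-upd x∉ ps

Consistent-split : ∀ {G Γ} Γ₁ Γ₂ → Γ ↭ Γ₁ ++ Γ₂ → Consistent G Γ →
                   Consistent G Γ₁ × Consistent G Γ₂
Consistent-split Γ₁ Γ₂ p c = All-++⁻ Γ₁ (All-resp-↭ p c)

junk : ℕ → Tm 0
junk _ = hyp (atom 0)

annotate : (ℕ → Ty) → Term → Tm 0
annotate G = ann junk (hyp ∘ G)

sound : ∀ {G Γ M ρ} → Consistent G Γ → Γ ⊢ M ∶ ρ → annotate G M ⊩ ρ
sound (p ∷ []) Ax rewrite p = ax
sound {G} c (⇒I {M = M} {σ} x h h′ d) =
  ƛI (trans (cnt-ann-body junk (hyp ∘ G) M) (⊢-countB M h h′ d))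
     (⊩-≡ (trans (ann-^ M lc tt)
            (cong₂ _⟨_⟩ (ann-cong M lc (λ _ _ → refl)
                           λ y y∈ → cong hyp (upd-other G x y λ { refl → h′ y∈ }))
                        (cong hyp (upd-same G x))))
          (sound (Consistent-∷ h c) d))
  where lc = Lc-open⁻ 0 M (⊢⇒Lc d)
sound c (⇒E {Γ₁ = Γ₁} {Γ₂} (p , _) d e) with c₁ , c₂ ← Consistent-split Γ₁ Γ₂ p c =
  ·E (sound c₁ d) (sound c₂ e)
sound c (∧I d e) = ∧I (sound c d) (sound c e)
sound c (∧E₁ d)  = ∧E₁ (sound c d)
sound c (∧E₂ d)  = ∧E₂ (sound c d)
sound c (∨I₁ d)  = ∨I₁ (sound c d)
sound c (∨I₂ d)  = ∨I₂ (sound c d)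
sound {G} c (∨E {Γ₁ = Γ₁} {Γ₂} {M} {N} {σ} {τ} {θ} {ρ} x (p , _) h d d′ e)
  with c₁ , c₂ ← Consistent-split Γ₁ Γ₂ p c
     | C , q ← ann-once x junk (hyp ∘ G) M (countF-once M h (↭-sym (⊢⇒dom↭fv d))) =
  ⊩-≡ (sym (trans (ann-subst {f′ = f′} (⊢⇒Lc e) M (upd-same _ x) (upd-other _ x))
                  (q (annotate G N) (trans (upd-same _ x) (sym (wk-id _)))
                     (λ y y≢x → sym (upd-other _ x y y≢x)))))
      -- `dist` turns `(σ ∨ τ) ∧ θ` into the union of the types assumed in the two branches.
      (split C (annotate G N) (branch d) (branch d′) (dist (sound c₂ e)))
  where
  f′ = upd (hyp ∘ G) x (annotate G N)
  branch : ∀ {α} → (x , α) ∷ Γ₁ ⊢ M ∶ ρ → C ⟦ hyp α ⟧ ⊩ ρ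
  branch {α} d = ⊩-≡ (q (hyp α) (cong hyp (upd-same G x))
                        (λ y y≢x → cong hyp (sym (upd-other G x y y≢x))))
                     (sound (Consistent-∷ h c₁) d)

-- From scoped to named typings.

infix 3 _∣_≈_

-- A leaf may carry any type that its assumption yields: a branch of `split` assumes `σ`, one of
-- (∨E) assumes `σ ∧ θ`.
data _∣_≈_ (G : ℕ → Ty) : ∀ {n} → Tm n → Term → Set where
  fvar : ∀ {n x α} → [ (x , G x) ] ⊢ fvar x ∶ α → G ∣ hyp {n} α ≈ fvar x
  bvar : ∀ {n} (i : Fin n) → G ∣ var i ≈ bvar (toℕ i)
  lam  : ∀ {n} {t : Tm (suc n)} {M} → G ∣ t ≈ M → G ∣ ƛ t ≈ lam M
  app  : ∀ {n} {t u : Tm n} {M N} → G ∣ t ≈ M → G ∣ u ≈ N → G ∣ t · u ≈ app M N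

ann-≈ : ∀ {n G} {b f : ℕ → Tm n} M → Lc n M → (∀ j → j < n → ∃[ i ] b j ≡ var i × toℕ i ≡ j) →
        (∀ x → f x ≡ hyp (G x)) → G ∣ ann b f M ≈ M
ann-≈ (bvar j) c p q with i , e , refl ← p j c rewrite e = bvar i
ann-≈ (fvar x) c p q rewrite q x = fvar Ax
ann-≈ (lam M) c p q = lam (ann-≈ M c
  (λ { zero _ → zero , refl , refl
     ; (suc j) (s≤s l) → let i , e , e′ = p j l in suc i , cong (ren suc) e , cong suc e′ })
  (λ x → cong (ren suc) (q x)))
ann-≈ (app M N) (c , c′) p q = app (ann-≈ M c p q) (ann-≈ N c′ p q)

annotate-≈ : ∀ {G} M → Lc 0 M → G ∣ annotate G M ≈ M
annotate-≈ M c = ann-≈ M c (λ _ ()) (λ _ → refl)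

≈-cong : ∀ {G G′ n} {t : Tm n} {M} → (∀ x → x ∈ fv M → G x ≡ G′ x) → G ∣ t ≈ M → G′ ∣ t ≈ M
≈-cong p (fvar {x = x} d) = fvar (subst (λ β → [ (x , β) ] ⊢ fvar x ∶ _) (p x (here refl)) d)
≈-cong p (bvar i)         = bvar i
≈-cong p (lam r)          = lam (≈-cong p r)
≈-cong p (app {M = M} r s) =
  app (≈-cong (λ x → p x ∘ ∈-++⁺ˡ) r) (≈-cong (λ x → p x ∘ ∈-++⁺ʳ (fv M)) s)

≈-ren⁻¹ : ∀ {G m n} {ρ : Fin m → Fin n} t {M} → (∀ i → toℕ (ρ i) ≡ toℕ i) →
          G ∣ ren ρ t ≈ M → G ∣ t ≈ M
≈-ren⁻¹ (var i) p (bvar _)  = subst (λ k → _ ∣ var i ≈ bvar k) (sym (p i)) (bvar i)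
≈-ren⁻¹ (hyp α) p (fvar d)  = fvar d
≈-ren⁻¹ (ƛ t)   p (lam r)   = lam (≈-ren⁻¹ t (λ { zero → refl ; (suc i) → cong suc (p i) }) r)
≈-ren⁻¹ (t · u) p (app r s) = app (≈-ren⁻¹ t p r) (≈-ren⁻¹ u p s)

≈-ren-suc : ∀ {G n x k} j {t : Tm n} → G ∣ t ≈ openAt k (fvar x) (bvar j) →
            G ∣ ren suc t ≈ openAt (suc k) (fvar x) (bvar (suc j))
≈-ren-suc {k = k} j r with j ≟ k | suc j ≟ suc k | r
... | yes _ | yes _ | fvar d = fvar d
... | no _  | no _  | bvar i = bvar (suc i)
... | yes p | no ¬q | _      = ⊥-elim (¬q (cong suc p))
... | no ¬p | yes q | _      = ⊥-elim (¬p (ℕ-suc-injective q))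

≈-open : ∀ {G m n x k} {σ : Fin m → Tm n} {t M} →
         (∀ i → G ∣ σ i ≈ openAt k (fvar x) (bvar (toℕ i))) →
         G ∣ t ≈ M → G ∣ sub σ t ≈ openAt k (fvar x) M
≈-open p (fvar d)  = fvar d
≈-open p (bvar i)  = p i
≈-open p (lam r)   = lam (≈-open (λ { zero → bvar zero ; (suc i) → ≈-ren-suc (toℕ i) (p i) }) r)
≈-open p (app r s) = app (≈-open p r) (≈-open p s)

δ≡countB : ∀ {n} (i j : Fin n) → δ i j ≡ countB (toℕ i) (bvar (toℕ j))
δ≡countB zero    zero    = refl
δ≡countB zero    (suc j) = refl
δ≡countB (suc i) zero    = refl
δ≡countB (suc i) (suc j) = trans (δ≡countB i j) (sym (countB-suc (toℕ i) (toℕ j)))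

≈-cnt : ∀ {G n} (i : Fin n) {t M} → G ∣ t ≈ M → cnt i t ≡ countB (toℕ i) M
≈-cnt i (fvar d)  = refl
≈-cnt i (bvar j)  = δ≡countB i j
≈-cnt i (lam r)   = ≈-cnt (suc i) r
≈-cnt i (app r s) = cong₂ _+_ (≈-cnt i r) (≈-cnt i s)

-- The shape of `M` that (∨E) demands. `body-≈` lets the assignment change at `x`, whose type
-- differs between the branches.
record Decomposition (G : ℕ → Ty) {n} (C : Ctx n) (N : Tm 0) (x : ℕ) (M : Term) : Set where
  field
    body arg : Term
    rest     : List ℕ
    arg-≈    : G ∣ N ≈ arg
    subst-≡  : M ≡ body [ arg / x ]
    fv-body  : fv body ↭ x ∷ rest
    fv-whole : fv M ↭ rest ++ fv arg
    body-≈   : ∀ {G′ α} → (∀ y → y ≢ x → G y ≡ G′ y) → [ (x , G′ x) ] ⊢ fvar x ∶ α →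
               G′ ∣ C ⟦ hyp α ⟧ ≈ body

open Decomposition

decompose : ∀ {G n} (C : Ctx n) N {x M} → x ∉ fv M → G ∣ C ⟦ N ⟧ ≈ M → Decomposition G C N x M
decompose hole N {x} {M} h r = record
  { body = fvar x ; arg = M ; rest = []
  ; arg-≈ = ≈-ren⁻¹ N (λ ()) r ; subst-≡ = sym (subst-self x)
  ; fv-body = ↭-refl ; fv-whole = ↭-refl ; body-≈ = λ _ d → fvar d }
decompose (C ◃ u) N {x} h (app {M = M} {S} r s) = record
  { body = app (body D) S ; arg = arg D ; rest = rest D ++ fv S
  ; arg-≈ = arg-≈ D
  ; subst-≡ = cong₂ app (subst-≡ D) (sym (subst-absent x S (countF-∉ x S (proj₂ (∉-++⁻ h)))))
  ; fv-body = ++⁺ʳ (fv S) (fv-body D)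
  ; fv-whole = ↭-trans (++⁺ʳ (fv S) (fv-whole D)) (++-swapʳ (rest D) (fv (arg D)) (fv S))
  ; body-≈ = λ p d → app (body-≈ D p d)
                       (≈-cong (λ y y∈ → p y λ { refl → proj₂ (∉-++⁻ {xs = fv M} h) y∈ }) s) }
  where D = decompose C N (proj₁ (∉-++⁻ h)) r
decompose (t ▹ C) N {x} h (app {M = S} {M} s r) = record
  { body = app S (body D) ; arg = arg D ; rest = fv S ++ rest D
  ; arg-≈ = arg-≈ D
  ; subst-≡ = cong₂ app (sym (subst-absent x S (countF-∉ x S (proj₁ (∉-++⁻ h))))) (subst-≡ D)
  ; fv-body = ↭-trans (++⁺ˡ (fv S) (fv-body D)) (shift x (fv S) (rest D))
  ; fv-whole = ↭-trans (++⁺ˡ (fv S) (fv-whole D)) (↭-sym (++-assoc (fv S) (rest D) (fv (arg D))))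
  ; body-≈ = λ p d → app (≈-cong (λ y y∈ → p y λ { refl → proj₁ (∉-++⁻ h) y∈ }) s)
                         (body-≈ D p d) }
  where D = decompose C N (proj₂ (∉-++⁻ {xs = fv S} h)) r
decompose (ƛ C) N h (lam r) = record
  { body = lam (body D) ; arg = arg D ; rest = rest D ; arg-≈ = arg-≈ D
  ; subst-≡ = cong lam (subst-≡ D) ; fv-body = fv-body D ; fv-whole = fv-whole D
  ; body-≈ = λ p d → lam (body-≈ D p d) }
  where D = decompose C N h r

⊢-↭ : ∀ {Γ Δ M σ} → Γ ↭ Δ → Γ ⊢ M ∶ σ → Δ ⊢ M ∶ σ
⊢-↭ p Ax with refl ← ↭-singleton-inv (↭-sym p) = Ax
⊢-↭ p (⇒I x h h′ d) = ⇒I x (h ∘ ∈-resp-↭ (↭-sym (map⁺ proj₁ p))) h′ (⊢-↭ (prep _ p) d)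
⊢-↭ p (⇒E (q , u) d e) = ⇒E (↭-trans (↭-sym p) q , u) d e
⊢-↭ p (∧I d e) = ∧I (⊢-↭ p d) (⊢-↭ p e)
⊢-↭ p (∧E₁ d)  = ∧E₁ (⊢-↭ p d)
⊢-↭ p (∧E₂ d)  = ∧E₂ (⊢-↭ p d)
⊢-↭ p (∨I₁ d)  = ∨I₁ (⊢-↭ p d)
⊢-↭ p (∨I₂ d)  = ∨I₂ (⊢-↭ p d)
⊢-↭ p (∨E x (q , u) h d d′ e) = ∨E x (↭-trans (↭-sym p) q , u) h d d′ e

env : (ℕ → Ty) → List ℕ → Env
env G = map (λ x → x , G x)

dom-env : ∀ G xs → dom (env G xs) ≡ xs
dom-env G xs = trans (sym (map-∘ xs)) (map-id xs)

env-cong : ∀ {G G′} xs → (∀ x → x ∈ xs → G x ≡ G′ x) → env G xs ≡ env G′ xs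
env-cong []       p = refl
env-cong (x ∷ xs) p = cong₂ _∷_ (cong (x ,_) (p x (here refl))) (env-cong xs (λ y → p y ∘ there))

env-upd : ∀ {G x σ xs ys} → x ∉ ys → xs ↭ x ∷ ys → env (upd G x σ) xs ↭ (x , σ) ∷ env G ys
env-upd {G} {x} {σ} {xs} {ys} h p =
  subst (env (upd G x σ) xs ↭_)
    (cong₂ (λ τ Γ → (x , τ) ∷ Γ) (upd-same G x)
      (env-cong ys λ y y∈ → upd-other G x y λ { refl → h y∈ }))
    (map⁺ _ p)

Unique-++⁻ : ∀ xs {ys : List ℕ} → Unique (xs ++ ys) → Unique xs × Unique ys
Unique-++⁻ []       u       = [] , u
Unique-++⁻ (x ∷ xs) (p ∷ u) with v , w ← Unique-++⁻ xs u = All-++⁻ˡ xs p ∷ v , w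

Unique-↭ : ∀ {xs ys : List ℕ} → xs ↭ ys → Unique xs → Unique ys
Unique-↭ p = Unique-resp-↭ (setoid ℕ) (↭⇒↭ₛ p)

Unique-∷ : ∀ {x} {xs : List ℕ} → x ∉ xs → Unique xs → Unique (x ∷ xs)
Unique-∷ {xs = xs} h u = ¬Any⇒All¬ xs h ∷ u

env-Split : ∀ {G xs} ys zs → xs ↭ ys ++ zs → Unique xs → Split (env G xs) (env G ys) (env G zs)
env-Split {G} {xs} ys zs p u =
  subst (env G xs ↭_) e (map⁺ _ p) ,
  subst Unique (trans (sym (dom-env G (ys ++ zs))) (cong dom e)) (Unique-↭ p u)
  where e = map-++ (λ x → x , G x) ys zs

fresh : ∀ (xs : List ℕ) → ∃[ x ] x ∉ xs
fresh xs = let x , h = bound xs in x , λ m → 1+n≰n (h m)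
  where
  bound : ∀ xs → ∃[ k ] ∀ {x} → x ∈ xs → x < k
  bound []       = 0 , λ ()
  bound (x ∷ xs) with k , h ← bound xs =
    suc x + k , λ { (here refl) → m≤m+n (suc x) k ; (there m) → ≤-trans (h m) (m≤n+m k (suc x)) }

-- The environment is read off the free variables of `M`, so it splits as `M` does.
complete : ∀ {G t M ρ} → t ⊩ ρ → G ∣ t ≈ M → Unique (fv M) → env G (fv M) ⊢ M ∶ ρ
complete ax (fvar d) u = d
complete {G} (ƛI {σ = σ} l d) (lam {M = M} r) u with x , h ← fresh (fv M) =
  ⇒I x (h ∘ subst (x ∈_) (dom-env G (fv M))) h
    (⊢-↭ (env-upd h p) (complete d
      (≈-open (λ { zero → fvar ax-x })
        (≈-cong (λ y y∈ → sym (upd-other G x y λ { refl → h y∈ })) r))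
      (Unique-↭ (↭-sym p) (Unique-∷ h u))))
  where
  p = fv-open-var M x (trans (sym (≈-cnt zero r)) l)
  ax-x : [ (x , upd G x σ x) ] ⊢ fvar x ∶ σ
  ax-x rewrite upd-same G x {σ} = Ax
complete (·E d e) (app {M = M} {N} r s) u with v , w ← Unique-++⁻ (fv M) u =
  ⇒E (env-Split (fv M) (fv N) ↭-refl u) (complete d r v) (complete e s w)
complete (∧I d e) r u = ∧I (complete d r u) (complete e r u)
complete (∧E₁ d)  r u = ∧E₁ (complete d r u)
complete (∧E₂ d)  r u = ∧E₂ (complete d r u)
complete (∨I₁ d)  r u = ∨I₁ (complete d r u)
complete (∨I₂ d)  r u = ∨I₂ (complete d r u)
complete {G} {M = M} (dist d) r u =
  subst (env G (fv M) ⊢_∶ _) (subst-self 0)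
    -- `dist` is (∨E) with a single variable as body; nothing else is assumed there, so the name 0
    -- is fresh.
    (∨E {M = fvar 0} 0 (env-Split [] (fv M) ↭-refl u) (λ ())
      (∨I₁ Ax) (∨I₂ Ax) (complete d r u))
complete {G} {M = M} (split {σ} {τ} {ρ} C N d d′ e) r u with x , h ← fresh (fv M) =
  subst (env G (fv M) ⊢_∶ ρ) (sym (subst-≡ D))
    (∨E x (env-Split (rest D) (fv (arg D)) (fv-whole D) u)
      (x∉rest ∘ subst (x ∈_) (dom-env G (rest D)))
      -- The side type `θ` is taken to be `σ ∨ τ` itself.
      (branch (∧E₁ Ax) d) (branch (∧E₁ Ax) d′) (∧I n n))
  where
  D = decompose C N h r
  uniq = Unique-++⁻ (rest D) (Unique-↭ (fv-whole D) u)
  x∉rest : x ∉ rest D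
  x∉rest = h ∘ ∈-resp-↭ (↭-sym (fv-whole D)) ∘ ∈-++⁺ˡ
  n = complete e (arg-≈ D) (proj₂ uniq)
  branch : ∀ {α γ} → [ (x , γ) ] ⊢ fvar x ∶ α → C ⟦ hyp α ⟧ ⊩ ρ →
           (x , γ) ∷ env G (rest D) ⊢ body D ∶ ρ
  branch {α} {γ} a d = ⊢-↭ (env-upd x∉rest (fv-body D)) (complete d
    (body-≈ D (λ y y≢x → sym (upd-other G x y y≢x))
      (subst (λ θ → [ (x , θ) ] ⊢ fvar x ∶ α) (sym (upd-same G x)) a))
    (Unique-↭ (↭-sym (fv-body D)) (Unique-∷ x∉rest (proj₁ uniq))))

-- Subject reduction.

consistent-env : ∀ {G Γ} → Consistent G Γ → env G (dom Γ) ≡ Γ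
consistent-env []       = refl
consistent-env (p ∷ ps) = cong₂ (λ α Γ → (_ , α) ∷ Γ) p (consistent-env ps)

consistent-assignment : ∀ Γ → Unique (dom Γ) → ∃[ G ] Consistent G Γ
consistent-assignment []            u       = (λ _ → atom 0) , []
consistent-assignment ((x , α) ∷ Γ) (p ∷ u) with G , c ← consistent-assignment Γ u =
  upd G x α , Consistent-∷ (All¬⇒¬Any p) c

-- The step is carried to scoped terms and back. As free variables are kept with multiplicities, the
-- environment read off `N` is `Γ` up to order.
subject-reduction : ∀ {Γ M N σ} → Unique (dom Γ) → Γ ⊢ M ∶ σ → M ⟶β N → Γ ⊢ N ∶ σ
subject-reduction {Γ} {M} {N} u d s
  with G , c ← consistent-assignment Γ u | k , h ← ⟶-Step s (⊢⇒Lc d) =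
  ⊢-↭ (subst (_ ↭_) (consistent-env c) (map⁺ _ p))
    (complete (preserved k (h junk (hyp ∘ G)) t) (annotate-≈ N (⟶-Lc s (⊢⇒Lc d)))
      (Unique-↭ (↭-sym p) u))
  where
  t = sound c d
  p : fv N ↭ dom Γ
  p = ↭-trans (⟶-fv s (⊢⇒Lc d) junk (hyp ∘ G) (⊩⇒LinearTm t)) (↭-sym (⊢⇒dom↭fv d))

mainTheorem7 : ∀ {Γ M N σ} → Linear M → Γ ⊢ M ∶ σ → M ⟶β* N → Γ ⊢ N ∶ σ
mainTheorem7 {Γ} {M} (_ , l) d = reduce d
  where
  unique : Unique (dom Γ)
  -- Distinct names in `fv M` make those of `Γ` distinct; as `Γ` never changes, this serves every
  -- step.
  unique = Unique-↭ (↭-sym (⊢⇒dom↭fv d))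
    (occ≤1⇒Unique (fv M) λ x → subst (_≤ 1) (sym (occ-fv x M)) (l x))
  reduce : ∀ {M N σ} → Γ ⊢ M ∶ σ → M ⟶β* N → Γ ⊢ N ∶ σ
  reduce d ε        = d
  reduce d (s ◅ ss) = reduce (subject-reduction unique d s) ss
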